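{- Let $k\in\{2,3\}$ and let $G$ be a $k$-cactus with $n$ vertices. Then $|E(G)|\le \left\lfloor \frac{(2k+1)(n-1)}{k+1}\right\rfloor$. Moreover, this bound is tight: for each $k\in\{2,3\}$ and each $n\ge 1$ there is a $k$-cactus with $n$ vertices and exactly $\left\lfloor \frac{(2k+1)(n-1)}{k+1}\right\rfloor$ edges.
   Context: All graphs are finite and simple. For an integer $k\ge 1$, a $k$-cactus is a connected graph in which every edge is contained in at most $k$ cycles. -}

module Defs where

open import Data.Nat using (ℕ; zero; suc; _+_; _*_; _∸_; _/_; _<?_; _<ᵇ_)
open import Data.Fin using (Fin; toℕ; fromℕ<)
open import Data.Bool using (Bool; true; false; if_then_else_; _∧_)
open import Data.List using (List; map; allFin)
open import Data.Nat.ListAction using (sum)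
open import Data.Product using (Σ; ∃; _×_; _,_)
open import Data.Sum using (_⊎_)
open import Function.Bundles using (_⇔_)
open import Function.Definitions using (Injective)
open import Relation.Nullary using (yes; no; ¬_)
open import Relation.Binary.PropositionalEquality using (_≡_)

record Graph (n : ℕ) : Set where
  field
    adj    : Fin n → Fin n → Bool
    sym    : ∀ i j → adj i j ≡ adj j i
    irrefl : ∀ i → adj i i ≡ false
open Graph public

edgeCount : ∀ {n} → Graph n → ℕ
edgeCount {n} G =
  sum (map (λ i → sum (map (λ j → if (toℕ i <ᵇ toℕ j) ∧ adj G i j then 1 else 0)
                           (allFin n)))
           (allFin n))

data Reach {n} (G : Graph n) : Fin n → Fin n → Set where
  here : ∀ {u} → Reach G u u
  step : ∀ {u v w} → adj G u v ≡ true → Reach G v w → Reach G u w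

Connected : ∀ {n} → Graph n → Set
Connected {n} G = ∀ (u v : Fin n) → Reach G u v

csuc : ∀ {m} → Fin (suc m) → Fin (suc m)
csuc {m} i with suc (toℕ i) <? suc m
... | yes p = fromℕ< p
... | no _  = Fin.zero

record Cycle {n} (G : Graph n) : Set where
  field
    l      : ℕ
    vtx    : Fin (suc (suc (suc l))) → Fin n
    inj    : Injective _≡_ _≡_ vtx
    closed : ∀ i → adj G (vtx i) (vtx (csuc i)) ≡ true
open Cycle public

CycleEdge : ∀ {n} {G : Graph n} → Cycle G → Fin n → Fin n → Set
CycleEdge C u v = ∃ λ i →
  (vtx C i ≡ u × vtx C (csuc i) ≡ v) ⊎ (vtx C i ≡ v × vtx C (csuc i) ≡ u)

-- Two cycle representations are the same cycle iff they have the same edge set.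
SameCycle : ∀ {n} {G : Graph n} → Cycle G → Cycle G → Set
SameCycle C D = ∀ u v → CycleEdge C u v ⇔ CycleEdge D u v

AtMostKCyclesPerEdge : ∀ {n} → ℕ → Graph n → Set
AtMostKCyclesPerEdge {n} k G =
  ∀ (u v : Fin n) → adj G u v ≡ true →
  (cs : Fin (suc k) → Cycle G) → (∀ i → CycleEdge (cs i) u v) →
  Σ (Fin (suc k)) λ i → Σ (Fin (suc k)) λ j → ¬ (i ≡ j) × SameCycle (cs i) (cs j)

IsKCactus : ∀ {n} → ℕ → Graph n → Set
IsKCactus k G = Connected G × AtMostKCyclesPerEdge k G

cactusBound : ℕ → ℕ → ℕ
cactusBound k n = ((2 * k + 1) * (n ∸ 1)) / suc k

{-# OPTIONS --safe #-}

-- Upper bound. Fix a spanning forest T, and for each edge e let P e be the set of forest edges on the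
-- fundamental cycle of e; equivalently, t lies in P e if e crosses the cut dual to t. Distinct edges have
-- distinct sets, and a chord has |P e| ≥ 2. If f is a chord and A a list of other chords, the sum over GF(2)
-- of the fundamental cycles of f and A contains a cycle through f, since otherwise some cut would meet that
-- sum in f alone. With A = [], [e], [g], [e , g] this bounds the number of chords whose sets meet P f: at most
-- k - 1 of them, and for k = 3 two such sets P e, P g cannot each share with P f an element missing from the
-- other. Hence meeting is an equivalence relation with classes of size at most k, and the union of the sets
-- of a class of size 1, 2, 3 has at least 2, 3, 4 elements. So (k + 1) |chords| ≤ k |T| ≤ k (n - 1).
--
-- Tightness. Books of k triangles with a common spine, glued at one endpoint of their spines, attain the
-- bound; for the remaining vertices the last book has fewer pages. A cycle consists of two pages of a book,
-- so a cycle through a given edge is determined by its second page.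

module Submission where

open import Defs hiding (sym; here; step; l)
open import Data.Nat using (ℕ; zero; suc; _+_; _*_; _∸_; _/_; _%_; _≤_; _<_; _<?_; _<ᵇ_; z≤n; s≤s)
open import Data.Nat.Properties using (≤-refl; ≤-trans; ≤-reflexive; ≤-pred; <-irrefl; <-asym; <⇒≱; <ᵇ⇒<; <⇒<ᵇ; n<1+n; n≤1+n; m≤n⇒m≤1+n; m≤n+m; m+n≤o⇒m≤o; n≢0⇒n>0; m≢1+n+m; +-comm; +-suc; +-mono-≤; +-monoʳ-≤; +-monoˡ-<; *-zeroʳ; *-monoʳ-≤; *-distribˡ-+; module ≤-Reasoning) renaming (_≟_ to _≟ⁿ_)
open import Data.Nat.DivMod using (m≡m%n+[m/n]*n; m%n<n; m*n/n≡m; m*n%n≡0; /-monoˡ-≤; +-distrib-/-∣ˡ)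
open import Data.Nat.Divisibility using (divides)
open import Data.Nat.ListAction using (sum)
open import Data.Nat.Solver using (module +-*-Solver)
open import Data.Fin using (Fin; zero; suc; toℕ; fromℕ; fromℕ<; inject₁; punchOut) renaming (_<_ to _<ᶠ_)
open import Data.Fin.Properties using (_≟_; any?; toℕ-injective; toℕ<n; toℕ-fromℕ; toℕ-fromℕ<; toℕ-inject₁; ≤fromℕ; pigeonhole; punchOut-injective) renaming (<-cmp to <ᶠ-cmp; suc-injective to Fin-suc-injective)
open import Data.Fin.Induction using (<-weakInduction; <-weakInduction-startingFrom)
open import Data.Fin.Relation.Unary.Top using (view; ‵fromℕ; ‵inject₁)
open import Data.Bool using (Bool; true; false; if_then_else_; _∧_; _∨_; _xor_; not; T)
open import Data.Bool.Properties using (xor-same; xor-comm; xor-identityʳ; ∧-identityʳ; ∧-comm; ∧-zeroʳ; ∧-distribˡ-xor; ∨-zeroʳ; not-involutive; not-¬; ¬-not) renaming (_≟_ to _≟ᵇ_)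
open import Data.Bool.Solver using (module xor-∧-Solver)
open import Data.Vec.Functional using () renaming (_∷_ to _∷ᶠ_)
open import Data.List using (List; []; _∷_; _++_; length; map; filter; tabulate; allFin; cartesianProduct)
open import Data.List.Properties using (filter-++; length-++; length-tabulate; map-tabulate)
open import Data.List.Membership.Propositional using (_∈_; _∉_)
open import Data.List.Membership.Propositional.Properties using (∈-tabulate⁺; ∈-tabulate⁻; ∈-++⁺ˡ; ∈-++⁺ʳ; ∈-++⁻; ∈-map⁺; ∈-map⁻; ∈-filter⁺; ∈-filter⁻; ∈-allFin)
open import Data.List.Relation.Unary.Any using (here; there)
open import Data.List.Relation.Unary.All as All using (All; []; _∷_)
open import Data.List.Relation.Unary.All.Properties using (all-filter) renaming (filter⁺ to All-filter⁺)
open import Data.List.Relation.Unary.AllPairs using ([]; _∷_)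
open import Data.List.Relation.Unary.Unique.Propositional using (Unique)
open import Data.List.Relation.Unary.Unique.Propositional.Properties using (filter⁺; cartesianProduct⁺; allFin⁺)
open import Data.List.Relation.Binary.Permutation.Propositional using (_↭_; prep; ↭-refl; ↭-sym; ↭-trans; ↭⇒↭ₛ)
open import Data.List.Relation.Binary.Permutation.Propositional.Properties using (shift; ∈-resp-↭; ↭-length)
import Data.List.Relation.Binary.Permutation.Setoid.Properties as Permₛ
open import Data.Product using (Σ; ∃; ∃₂; _×_; _,_; proj₁; proj₂)
open import Data.Sum using (_⊎_; inj₁; inj₂; [_,_]) renaming (map to map-⊎; swap to swap-⊎)
open import Data.Empty using (⊥; ⊥-elim)
open import Function using (_∘_; id)
open import Function.Bundles using (mk⇔; Equivalence)
open import Function.Definitions using (Injective)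
open import Relation.Nullary using (Dec; yes; no; does; ¬_; ¬?; contradiction)
open import Relation.Nullary.Decidable using (dec-true; dec-false; decidable-stable; _×-dec_)
open import Relation.Binary.Construct.Closure.ReflexiveTransitive using (Star; ε; _◅_; _◅◅_; reverse) renaming (map to map-Star)
open import Relation.Binary.Definitions using (tri<; tri≈; tri>)
open import Relation.Binary.PropositionalEquality using (_≡_; _≢_; refl; sym; trans; cong; cong₂; subst; subst₂; setoid; module ≡-Reasoning)

private variable
  m n : ℕ

-- Cardinalities of Boolean predicates on Fin n

count : (Fin n → Bool) → ℕ
count {zero}  p = 0
count {suc n} p = (if p zero then 1 else 0) + count (p ∘ suc)

count≤n : (p : Fin n → Bool) → count p ≤ n
count≤n {zero}  p = z≤n
count≤n {suc n} p with p zero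
... | true  = s≤s (count≤n (p ∘ suc))
... | false = m≤n⇒m≤1+n (count≤n (p ∘ suc))

_⊑_ : (p q : Fin n → Bool) → Set
p ⊑ q = ∀ i → p i ≡ true → q i ≡ true

-- Strict and weak monotonicity of `count` below come from this estimate, with one of the two
-- disjoint predicates a point or empty.
count-disjoint : (p q r : Fin n → Bool) → p ⊑ r → q ⊑ r →
  (∀ i → p i ≡ true → q i ≡ true → ⊥) → count p + count q ≤ count r
count-disjoint {zero}  p q r p⊑r q⊑r dis = z≤n
count-disjoint {suc n} p q r p⊑r q⊑r dis
  with p zero | q zero | r zero | p⊑r zero | q⊑r zero | dis zero
     | count-disjoint (p ∘ suc) (q ∘ suc) (r ∘ suc) (p⊑r ∘ suc) (q⊑r ∘ suc) (dis ∘ suc)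
... | true  | true  | _     | _ | _ | d | _  = ⊥-elim (d refl refl)
... | true  | false | true  | _ | _ | _ | ih = s≤s ih
... | true  | false | false | a | _ | _ | _  = contradiction (a refl) λ ()
... | false | true  | true  | _ | _ | _ | ih rewrite +-suc (count (p ∘ suc)) (count (q ∘ suc)) = s≤s ih
... | false | true  | false | _ | a | _ | _  = contradiction (a refl) λ ()
... | false | false | true  | _ | _ | _ | ih = m≤n⇒m≤1+n ih
... | false | false | false | _ | _ | _ | ih = ih

count-positive : (p : Fin n → Bool) (i : Fin n) → p i ≡ true → 1 ≤ count p
count-positive p zero    pi rewrite pi = s≤s z≤n
count-positive p (suc i) pi with p zero
... | true  = s≤s z≤n
... | false = count-positive (p ∘ suc) i pi

count-strict : (p q : Fin n → Bool) → p ⊑ q → ∀ i → p i ≡ false → q i ≡ true → count p < count q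
count-strict p q p⊑q i pi qi = begin
  suc (count p)         ≡⟨ +-comm 1 (count p) ⟩
  count p + 1           ≤⟨ +-monoʳ-≤ (count p) (count-positive point i (dec-true (i ≟ i) refl)) ⟩
  count p + count point ≤⟨ count-disjoint p point q p⊑q point⊑q disjoint ⟩
  count q               ∎
  where
  open ≤-Reasoning
  point = λ j → does (i ≟ j)
  point⊑q : point ⊑ q
  point⊑q j eq with i ≟ j
  ... | yes refl = qi
  disjoint : ∀ j → p j ≡ true → point j ≡ true → ⊥
  disjoint j pj eq with i ≟ j
  ... | yes refl = contradiction (trans (sym pi) pj) λ ()

count-two : (p : Fin m → Bool) {i j : Fin m} → i ≢ j → p i ≡ true → p j ≡ true → 2 ≤ count p
count-two p {i} {j} i≢j pi pj = ≤-trans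
  (s≤s (count-positive point i (dec-true (i ≟ i) refl)))
  (count-strict point p point⊑p j (dec-false (i ≟ j) i≢j) pj)
  where
  point = λ w → does (i ≟ w)
  point⊑p : point ⊑ p
  point⊑p w eq with i ≟ w
  ... | yes refl = pi

count-mono : (p q : Fin n → Bool) → p ⊑ q → count p ≤ count q
count-mono p q p⊑q = ≤-trans (m≤n+m (count p) _) (count-disjoint (λ _ → false) p q (λ _ ()) p⊑q (λ _ ()))

count-none : (p : Fin n → Bool) → (∀ i → p i ≢ true) → count p ≡ 0
count-none {zero}  p none = refl
count-none {suc n} p none with p zero in eq
... | true  = contradiction eq (none zero)
... | false = count-none (p ∘ suc) (none ∘ suc)

count-all : (p : Fin n → Bool) → (∀ i → p i ≡ true) → count p ≡ n
count-all {zero}  p all = refl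
count-all {suc n} p all rewrite all zero = cong suc (count-all (p ∘ suc) (all ∘ suc))

count-unique : (p : Fin n → Bool) (h : Fin n) → p h ≡ true → (∀ i → p i ≡ true → i ≡ h) → count p ≡ 1
count-unique p zero    ph only rewrite ph = cong suc (count-none (p ∘ suc) λ i pi → contradiction (only (suc i) pi) λ ())
count-unique p (suc h) ph only with p zero in eq
... | true  = contradiction (only zero eq) λ ()
... | false = count-unique (p ∘ suc) h ph λ i pi → Fin-suc-injective (only (suc i) pi)

-- Walks, simple paths and cycles

Edge : ℕ → Set
Edge n = Fin n × Fin n

Cut : ℕ → Set
Cut n = Fin n → Bool

-- Over GF(2) this is the coboundary of the vertex function `D`; it is linear in `D`, which allows
-- cuts to be added.
cross : Cut n → Edge n → Bool
cross D (x , y) = D x xor D y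

-- Edge lists hold an edge in one orientation, but a walk may traverse it in both.
Arc : List (Edge n) → Fin n → Fin n → Set
Arc S x y = (x , y) ∈ S ⊎ (y , x) ∈ S

xor-false⇒≡ : ∀ a b → a xor b ≡ false → a ≡ b
xor-false⇒≡ true  true  _ = refl
xor-false⇒≡ false false _ = refl

module _ (R : Fin n → Fin n → Set) where
  mutual
    -- Each `cons` carries the freshness of its vertex, so `verts` is an injective enumeration, the
    -- form in which `Cycle` lists its vertices.
    data Path : ℕ → Fin n → Fin n → Set where
      stop : ∀ u → Path 0 u u
      cons : ∀ {l v w} u → R u v → (p : Path l v w) → (∀ i → verts p i ≢ u) → Path (suc l) u w

    verts : ∀ {l u v} → Path l u v → Fin (suc l) → Fin n
    verts (stop u)       _       = u
    verts (cons u _ _ _) zero    = u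
    verts (cons _ _ p _) (suc i) = verts p i

module _ {R : Fin n → Fin n → Set} where

  verts-first : ∀ {l u v} (p : Path R l u v) → verts R p zero ≡ u
  verts-first (stop u)       = refl
  verts-first (cons u _ _ _) = refl

  verts-last : ∀ {l u v} (p : Path R l u v) → verts R p (fromℕ l) ≡ v
  verts-last (stop u)       = refl
  verts-last (cons _ _ p _) = verts-last p

  verts-step : ∀ {l u v} (p : Path R l u v) (i : Fin l) →
    R (verts R p (inject₁ i)) (verts R p (suc i))
  verts-step (cons u r p _) zero    rewrite verts-first p = r
  verts-step (cons u r p _) (suc i) = verts-step p i

  verts-injective : ∀ {l u v} (p : Path R l u v) → Injective _≡_ _≡_ (verts R p)
  verts-injective (stop u)           {zero}  {zero}  _  = refl
  verts-injective (cons u r p fresh) {zero}  {zero}  _  = refl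
  verts-injective (cons u r p fresh) {zero}  {suc j} eq = contradiction (sym eq) (fresh j)
  verts-injective (cons u r p fresh) {suc i} {zero}  eq = contradiction eq (fresh i)
  verts-injective (cons u r p fresh) {suc i} {suc j} eq = cong suc (verts-injective p eq)

  suffix : ∀ {l u v} (p : Path R l u v) i → ∃ λ l′ → Path R l′ (verts R p i) v
  suffix p@(stop u)         i       = _ , p
  suffix p@(cons u r q f)   zero    = _ , p
  suffix (cons u r q f)     (suc i) = suffix q i

  erase-loops : ∀ {u v} → Star R u v → ∃ λ l → Path R l u v
  erase-loops {u} ε = 0 , stop u
  erase-loops {u} (r ◅ w) with l , p ← erase-loops w
    with any? (λ i → verts R p i ≟ u)
  -- The new vertex already lies on the path: the loop is cut off by keeping the part from that
  -- vertex on.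
  ... | yes (i , refl) = suffix p i
  ... | no  fresh      = suc l , cons u r p (λ i eq → fresh (i , eq))

  path-crosses : ∀ {l u v} (p : Path R l u v) (D : Cut n) → cross D (u , v) ≡ true →
    ∃ λ (i : Fin l) → cross D (verts R p (inject₁ i) , verts R p (suc i)) ≡ true
  path-crosses (stop u) D eq = contradiction (trans (sym eq) (xor-same (D u))) λ ()
  path-crosses (cons {v = x} u r p _) D eq with D u xor D x in here-eq
  ... | true  = zero , trans (cong (λ z → D u xor D z) (verts-first p)) here-eq
  ... | false with i , c ← path-crosses p D (trans (cong (_xor D _) (sym (xor-false⇒≡ (D u) (D x) here-eq))) eq) = suc i , c
csuc-inject₁ : (i : Fin m) → csuc (inject₁ i) ≡ suc i
csuc-inject₁ {m} i with suc (toℕ (inject₁ i)) <? suc m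
... | yes p = toℕ-injective (trans (toℕ-fromℕ< p) (cong suc (toℕ-inject₁ i)))
... | no ¬p = contradiction (s≤s (≤-trans (≤-reflexive (cong suc (toℕ-inject₁ i))) (toℕ<n i))) ¬p

csuc-fromℕ : ∀ m → csuc (fromℕ m) ≡ zero
csuc-fromℕ m with suc (toℕ (fromℕ m)) <? suc m
... | yes p = contradiction (subst (λ z → suc z < suc m) (toℕ-fromℕ m) p) (λ q → <-irrefl refl q)
... | no _ = refl

-- Greedy spanning forests

-- rep picks a vertex of each component, so its fixed points count the components.
record Forest (L : List (Edge n)) : Set where
  field
    size     : ℕ
    tree     : Fin size → Edge n
    chords   : List (Edge n)
    split    : L ↭ tabulate tree ++ chords
    D        : Fin size → Cut n
    dual     : ∀ i j → cross (D i) (tree j) ≡ does (i ≟ j)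
    rep      : Fin n → Fin n
    rep-idem : ∀ w → rep (rep w) ≡ rep w
    rep-edge : ∀ {e} → e ∈ L → rep (proj₁ e) ≡ rep (proj₂ e)
    rep-walk : ∀ w → Star (Arc (tabulate tree)) w (rep w)
    small    : size + count (λ w → does (rep w ≟ w)) ≤ n

cross-twist : (D K : Cut n) (b : Bool) (e : Edge n) →
  cross (λ w → D w xor (b ∧ K w)) e ≡ cross D e xor (b ∧ cross K e)
cross-twist D K b (x , y) = solve 5 (λ p q b r s →
  (p :+ b :* r) :+ (q :+ b :* s) := (p :+ q) :+ b :* (r :+ s)) refl (D x) (D y) b (K x) (K y)
  where open xor-∧-Solver

-- A fibre of `c` is a cut that no edge within a fibre crosses; with `c` the map to representatives,
-- the fibres are the components.
cross-class : (c : Fin n → Fin n) (u : Fin n) (e : Edge n) → c (proj₁ e) ≡ c (proj₂ e) →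
  cross (λ w → does (c w ≟ u)) e ≡ false
cross-class c u (x , y) eq rewrite eq = xor-same (does (c y ≟ u))

Arc-sym : ∀ {S : List (Edge n)} {x y} → Arc S x y → Arc S y x
Arc-sym = swap-⊎

Arc-mono : ∀ {S T : List (Edge n)} → (∀ {e} → e ∈ S → e ∈ T) → ∀ {x y} → Arc S x y → Arc T x y
Arc-mono S⊆T = map-⊎ S⊆T S⊆T

module _ {L : List (Edge n)} (F : Forest L) (u v : Fin n) where
  open Forest F

  add-chord : rep u ≡ rep v → Forest ((u , v) ∷ L)
  add-chord eq = record
    { Forest F
    ; chords   = (u , v) ∷ chords
    ; split    = ↭-trans (prep _ split) (↭-sym (shift _ (tabulate tree) chords))
    ; rep-edge = λ { (here refl) → eq ; (there e∈L) → rep-edge e∈L } }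

  module _ (u≁v : rep u ≢ rep v) where
    private
      K : Cut n
      K w = does (rep w ≟ rep u)

      K-new : cross K (u , v) ≡ true
      K-new rewrite dec-true (rep u ≟ rep u) refl | dec-false (rep v ≟ rep u) (u≁v ∘ sym) = refl

      tree∈ : ∀ i → tree i ∈ L
      tree∈ i = ∈-resp-↭ (↭-sym split) (∈-++⁺ˡ (∈-tabulate⁺ i))

      K-old : ∀ i → cross K (tree i) ≡ false
      K-old i = cross-class rep (rep u) (tree i) (rep-edge (tree∈ i))

      -- The component `K` of `u` is the dual cut of the new edge. Adding it to every old dual cut
      -- that the new edge crosses cancels that crossing, and no old forest edge crosses `K`.
      D′ : Fin (suc size) → Cut n
      D′ zero    = K
      D′ (suc i) = λ w → D i w xor (cross (D i) (u , v) ∧ K w)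

      tree′ : Fin (suc size) → Edge n
      tree′ = (u , v) ∷ᶠ tree

      dual′ : ∀ i j → cross (D′ i) (tree′ j) ≡ does (i ≟ j)
      dual′ zero    zero    = K-new
      dual′ zero    (suc j) = K-old j
      dual′ (suc i) zero    = begin
        cross (D′ (suc i)) (u , v)        ≡⟨ cross-twist (D i) K b (u , v) ⟩
        b xor (b ∧ cross K (u , v))       ≡⟨ cong (λ z → b xor (b ∧ z)) K-new ⟩
        b xor (b ∧ true)                  ≡⟨ cong (b xor_) (∧-identityʳ b) ⟩
        b xor b                           ≡⟨ xor-same b ⟩
        false                             ∎
        where open ≡-Reasoning
              b = cross (D i) (u , v)
      dual′ (suc i) (suc j) = begin
        cross (D′ (suc i)) (tree j)                     ≡⟨ cross-twist (D i) K b (tree j) ⟩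
        cross (D i) (tree j) xor (b ∧ cross K (tree j)) ≡⟨ cong₂ (λ y z → y xor (b ∧ z)) (dual i j) (K-old j) ⟩
        does (i ≟ j) xor (b ∧ false)                    ≡⟨ absorb (does (i ≟ j)) b ⟩
        does (i ≟ j)                                    ∎
        where
        open ≡-Reasoning
        b = cross (D i) (u , v)
        absorb : ∀ a b → a xor (b ∧ false) ≡ a
        absorb true  true  = refl
        absorb true  false = refl
        absorb false true  = refl
        absorb false false = refl

      rep′ : Fin n → Fin n
      rep′ w = if K w then rep v else rep w

      rep′-in : ∀ {w} → rep w ≡ rep u → rep′ w ≡ rep v
      rep′-in {w} eq rewrite dec-true (rep w ≟ rep u) eq = refl

      rep′-out : ∀ {w} → rep w ≢ rep u → rep′ w ≡ rep w
      rep′-out {w} neq rewrite dec-false (rep w ≟ rep u) neq = refl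

      rep′-cong : ∀ {x y} → rep x ≡ rep y → rep′ x ≡ rep′ y
      rep′-cong eq rewrite eq = refl

      rep′-rep : ∀ w → rep′ (rep w) ≡ rep′ w
      rep′-rep w = rep′-cong (rep-idem w)

      rep′-v : rep′ v ≡ rep v
      rep′-v = rep′-out (u≁v ∘ sym)

      rep′-idem : ∀ w → rep′ (rep′ w) ≡ rep′ w
      rep′-idem w with rep w ≟ rep u
      ... | yes _ = trans (rep′-rep v) rep′-v
      ... | no  p = trans (rep′-rep w) (rep′-out p)

      widen : ∀ {x y} → Star (Arc (tabulate tree)) x y → Star (Arc (tabulate tree′)) x y
      widen = map-Star (Arc-mono there)

      rep′-walk : ∀ w → Star (Arc (tabulate tree′)) w (rep′ w)
      rep′-walk w with rep w ≟ rep u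
      -- Here `w` lies in the component of `u`: the walk runs to the old representative, back to
      -- `u`, over the new edge, and on to the representative of `v`.
      ... | yes eq = subst (Star _ w) eq (widen (rep-walk w)) ◅◅ reverse Arc-sym (widen (rep-walk u))
                       ◅◅ (inj₁ (here refl) ◅ widen (rep-walk v))
      ... | no  _  = widen (rep-walk w)

      rep′-edge : ∀ {e} → e ∈ (u , v) ∷ L → rep′ (proj₁ e) ≡ rep′ (proj₂ e)
      rep′-edge (here refl) = trans (rep′-in refl) (sym rep′-v)
      rep′-edge (there e∈L) = rep′-cong (rep-edge e∈L)

      fixed′⊑fixed : (λ w → does (rep′ w ≟ w)) ⊑ (λ w → does (rep w ≟ w))
      fixed′⊑fixed w eq with rep w ≟ rep u
      fixed′⊑fixed w eq | yes _ with rep v ≟ w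
      ... | yes refl = dec-true (_ ≟ _) (rep-idem v)
      fixed′⊑fixed w eq | no  _ = eq

      -- After the merger `rep u` is no longer fixed, which pays for the additional forest edge in
      -- `small`.
      fewer : count (λ w → does (rep′ w ≟ w)) < count (λ w → does (rep w ≟ w))
      fewer = count-strict _ _ fixed′⊑fixed (rep u)
        (dec-false (_ ≟ _) (λ eq → u≁v (sym (trans (sym (rep′-in (rep-idem u))) eq))))
        (dec-true (_ ≟ _) (rep-idem u))

    add-tree : Forest ((u , v) ∷ L)
    add-tree = record
      { size = suc size ; tree = tree′ ; chords = chords ; split = prep _ split
      ; D = D′ ; dual = dual′ ; rep = rep′ ; rep-idem = rep′-idem ; rep-edge = rep′-edge
      ; rep-walk = rep′-walk
      ; small = ≤-trans (≤-reflexive (sym (+-suc size _))) (≤-trans (+-monoʳ-≤ size fewer) small) }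

forest : (L : List (Edge n)) → Forest L
forest [] = record
  { size = 0 ; tree = λ () ; chords = [] ; split = ↭-refl ; D = λ () ; dual = λ ()
  ; rep = id ; rep-idem = λ _ → refl ; rep-edge = λ () ; rep-walk = λ _ → ε ; small = count≤n _ }
forest ((u , v) ∷ L) with F ← forest L with Forest.rep F u ≟ Forest.rep F v
... | yes eq = add-chord F u v eq
... | no neq = add-tree F u v neq

module _ (G : Graph n) where

  IsEdge : Edge n → Set
  IsEdge (x , y) = adj G x y ≡ true

  Uses : Cycle G → Edge n → Set
  Uses C (x , y) = CycleEdge C x y

  -- The field `meets` is what is kept of the parity of cuts and cycles: a cut crossed by `f` is
  -- also crossed by an edge of the cycle taken from `S`.
  record CycleWithin (S : List (Edge n)) (f : Edge n) : Set where
    field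
      cycle   : Cycle G
      through : Uses cycle f
      within  : ∀ {x y} → CycleEdge cycle x y → Arc (f ∷ S) x y
      meets   : ∀ D → cross D f ≡ true → ∃ λ e → e ∈ S × cross D e ≡ true × Uses cycle e

  module _ (S : List (Edge n)) (S⊆G : ∀ {e} → e ∈ S → IsEdge e) (f : Edge n) (f∈G : IsEdge f) where
    private
      u v : Fin n
      u = proj₁ f
      v = proj₂ f

    -- Length at least two gives the three vertices that a cycle needs; `f` is the closing edge, at
    -- the last index.
    close-path : ∀ {l} → Path (Arc S) (suc (suc l)) u v → CycleWithin S f
    close-path {l} p = record { cycle = C ; through = fromℕ _ , inj₂ (verts-last p , wrap) ; within = within ; meets = meets }
      where
      next : ∀ i → verts _ p (csuc (inject₁ i)) ≡ verts _ p (suc i)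
      next i = cong (verts _ p) (csuc-inject₁ i)

      wrap : verts _ p (csuc (fromℕ (suc (suc l)))) ≡ u
      wrap = trans (cong (verts _ p) (csuc-fromℕ _)) (verts-first p)

      arc : ∀ i → Arc (f ∷ S) (verts _ p i) (verts _ p (csuc i))
      arc i with view i
      ... | ‵fromℕ     = inj₂ (here (cong₂ _,_ wrap (verts-last p)))
      ... | ‵inject₁ j = subst (Arc (f ∷ S) _) (sym (next j)) (Arc-mono there (verts-step p j))

      arc⇒adj : ∀ {x y} → Arc (f ∷ S) x y → adj G x y ≡ true
      arc⇒adj (inj₁ (here refl)) = f∈G
      arc⇒adj (inj₁ (there e∈S)) = S⊆G e∈S
      arc⇒adj (inj₂ (here refl)) = trans (Graph.sym G _ _) f∈G
      arc⇒adj (inj₂ (there e∈S)) = trans (Graph.sym G _ _) (S⊆G e∈S)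

      C : Cycle G
      C = record { vtx = verts _ p ; inj = verts-injective p ; closed = λ i → arc⇒adj (arc i) }

      within : ∀ {x y} → CycleEdge C x y → Arc (f ∷ S) x y
      within (i , inj₁ (refl , refl)) = arc i
      within (i , inj₂ (refl , refl)) = Arc-sym (arc i)

      meets : ∀ D → cross D f ≡ true → ∃ λ e → e ∈ S × cross D e ≡ true × Uses C e
      meets D eq with i , cr ← path-crosses p D eq with verts-step p i
      ... | inj₁ e∈S = _ , e∈S , cr , inject₁ i , inj₁ (refl , next i)
      ... | inj₂ e∈S = _ , e∈S , trans (xor-comm (D (verts _ p (suc i))) _) cr , inject₁ i , inj₂ (refl , next i)

    -- If the endpoints of `f` lie in one component of `S`, a loop-erased walk between them closes
    -- up with `f`; otherwise the component of `u` is the cut. The two hypotheses exclude paths of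
    -- length 0 and 1.
    cycle-or-cut : u ≢ v → ¬ Arc S u v →
      CycleWithin S f ⊎ ∃ λ D → cross D f ≡ true × (∀ {e} → e ∈ S → cross D e ≡ false)
    cycle-or-cut u≢v ¬arc with F ← forest S with Forest.rep F u ≟ Forest.rep F v
    ... | no neq = inj₂
      ( (λ w → does (rep w ≟ rep u))
      , cong₂ _xor_ (dec-true (rep u ≟ rep u) refl) (dec-false (rep v ≟ rep u) (neq ∘ sym))
      , λ {e} e∈S → cross-class rep (rep u) e (rep-edge e∈S) )
      where open Forest F
    ... | yes eq with erase-loops (map-Star (Arc-mono (∈-resp-↭ (↭-sym split) ∘ ∈-++⁺ˡ))
                       (rep-walk u ◅◅ subst (λ z → Star _ z v) (sym eq) (reverse Arc-sym (rep-walk v))))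
      where open Forest F
    ...   | zero , stop _ = contradiction refl u≢v
    ...   | suc zero , cons _ a (stop _) _ = contradiction a ¬arc
    ...   | suc (suc l) , p = inj₁ (close-path p)

-- Fundamental cycles over GF(2)

⨁ : (Fin m → Bool) → Bool
⨁ {zero}  p = false
⨁ {suc m} p = p zero xor ⨁ (p ∘ suc)

⨁-cong : {p q : Fin m → Bool} → (∀ i → p i ≡ q i) → ⨁ p ≡ ⨁ q
⨁-cong {zero}  eq = refl
⨁-cong {suc m} eq = cong₂ _xor_ (eq zero) (⨁-cong (eq ∘ suc))

⨁-zero : (p : Fin m → Bool) → (∀ i → p i ≡ false) → ⨁ p ≡ false
⨁-zero {zero}  p eq = refl
⨁-zero {suc m} p eq rewrite eq zero = ⨁-zero (p ∘ suc) (eq ∘ suc)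

⨁-true : (p : Fin m → Bool) → ⨁ p ≡ true → ∃ λ i → p i ≡ true
⨁-true {suc m} p eq with p zero in eq₀
... | true  = zero , eq₀
... | false with i , pi ← ⨁-true (p ∘ suc) eq = suc i , pi

⨁-xor : (p q : Fin m → Bool) → ⨁ (λ i → p i xor q i) ≡ ⨁ p xor ⨁ q
⨁-xor {zero}  p q = refl
⨁-xor {suc m} p q rewrite ⨁-xor (p ∘ suc) (q ∘ suc) =
  solve 4 (λ a b c d → (a :+ b) :+ (c :+ d) := (a :+ c) :+ (b :+ d)) refl (p zero) (q zero) (⨁ (p ∘ suc)) (⨁ (q ∘ suc))
  where open xor-∧-Solver

⨁-point : (p : Fin m → Bool) (j : Fin m) → ⨁ (λ i → p i ∧ does (i ≟ j)) ≡ p j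
⨁-point p zero = begin
  (p zero ∧ true) xor ⨁ (λ i → p (suc i) ∧ false) ≡⟨ cong₂ _xor_ (∧-identityʳ (p zero)) (⨁-zero _ (λ i → ∧-comm (p (suc i)) false)) ⟩
  p zero xor false                                ≡⟨ xor-identityʳ _ ⟩
  p zero                                          ∎
  where open ≡-Reasoning
⨁-point p (suc j) = trans (cong (_xor ⨁ (λ i → p (suc i) ∧ does (i ≟ j))) (∧-comm (p zero) false)) (⨁-point (p ∘ suc) j)

cross-⨁ : (D : Cut n) (a : Fin m → Bool) (K : Fin m → Cut n) (e : Edge n) →
  cross (λ w → D w xor ⨁ (λ i → a i ∧ K i w)) e ≡ cross D e xor ⨁ (λ i → a i ∧ cross (K i) e)
cross-⨁ D a K (x , y) = begin
  (D x xor ⨁ f) xor (D y xor ⨁ g)  ≡⟨ solve 4 (λ a b c d → (a :+ b) :+ (c :+ d) := (a :+ c) :+ (b :+ d)) refl (D x) (⨁ f) (D y) (⨁ g) ⟩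
  (D x xor D y) xor (⨁ f xor ⨁ g)  ≡⟨ cong ((D x xor D y) xor_) (sym (⨁-xor f g)) ⟩
  (D x xor D y) xor ⨁ (λ i → f i xor g i) ≡⟨ cong ((D x xor D y) xor_) (⨁-cong (λ i → sym (∧-distribˡ-xor (a i) (K i x) (K i y)))) ⟩
  (D x xor D y) xor ⨁ (λ i → a i ∧ cross (K i) (x , y)) ∎
  where
  open ≡-Reasoning
  open xor-∧-Solver using (solve; _:+_; _:=_)
  f = λ i → a i ∧ K i x
  g = λ i → a i ∧ K i y

module Fundamental {L : List (Edge n)} (F : Forest L) where
  open Forest F public

  -- The fundamental cycle of e consists of e and the forest edges whose dual cuts it crosses.
  P : Edge n → Fin size → Bool
  P e i = cross (D i) e

  -- `K` is constant along forest walks, and both endpoints of an edge of `L` walk to the same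
  -- representative.
  uncrossed : ∀ K → (∀ i → cross K (tree i) ≡ false) → ∀ {e} → e ∈ L → cross K e ≡ false
  uncrossed K none {x , y} e∈L = begin
    K x xor K y             ≡⟨ cong₂ _xor_ (along (rep-walk x)) (along (rep-walk y)) ⟩
    K (rep x) xor K (rep y) ≡⟨ cong (λ z → K z xor K (rep y)) (rep-edge e∈L) ⟩
    K (rep y) xor K (rep y) ≡⟨ xor-same (K (rep y)) ⟩
    false                   ∎
    where
    open ≡-Reasoning
    one : ∀ {a b} → (a , b) ∈ tabulate tree → K a ≡ K b
    one ab∈T with i , eq ← ∈-tabulate⁻ ab∈T = xor-false⇒≡ _ _ (trans (cong (cross K) eq) (none i))
    along : ∀ {a b} → Star (Arc (tabulate tree)) a b → K a ≡ K b
    along ε            = refl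
    along (inj₁ q ◅ w) = trans (one q) (along w)
    along (inj₂ q ◅ w) = trans (sym (one q)) (along w)

  -- Adding to K the dual cuts of the forest edges crossing K yields a cut that no forest edge crosses.
  expand : ∀ K {e} → e ∈ L → cross K e ≡ ⨁ (λ i → cross K (tree i) ∧ P e i)
  expand K {e} e∈L = xor-false⇒≡ _ _ (trans (sym (cross-⨁ K a D e)) (uncrossed K′ none e∈L))
    where
    a : Fin size → Bool
    a i = cross K (tree i)
    K′ : Cut n
    K′ w = K w xor ⨁ (λ i → a i ∧ D i w)
    none : ∀ j → cross K′ (tree j) ≡ false
    none j = begin
      cross K′ (tree j)                                   ≡⟨ cross-⨁ K a D (tree j) ⟩
      a j xor ⨁ (λ i → a i ∧ cross (D i) (tree j))        ≡⟨ cong (a j xor_) (⨁-cong (λ i → cong (a i ∧_) (dual i j))) ⟩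
      a j xor ⨁ (λ i → a i ∧ does (i ≟ j))                ≡⟨ cong (a j xor_) (⨁-point a j) ⟩
      a j xor a j                                         ≡⟨ xor-same (a j) ⟩
      false                                               ∎
      where open ≡-Reasoning

  tree∈L : ∀ i → tree i ∈ L
  tree∈L i = ∈-resp-↭ (↭-sym split) (∈-++⁺ˡ (∈-tabulate⁺ i))

  chord∈L : ∀ {e} → e ∈ chords → e ∈ L
  chord∈L e∈N = ∈-resp-↭ (↭-sym split) (∈-++⁺ʳ (tabulate tree) e∈N)

  ΣP : List (Edge n) → Fin size → Bool
  ΣP []      i = false
  ΣP (a ∷ A) i = P a i xor ΣP A i

  -- Summing the expansion of `K` over `A`, each member contributes `cross K a`, which vanishes.
  expand-Σ : ∀ K (A : List (Edge n)) → (∀ {a} → a ∈ A → a ∈ L) → (∀ {a} → a ∈ A → cross K a ≡ false) →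
    ⨁ (λ i → cross K (tree i) ∧ ΣP A i) ≡ false
  expand-Σ K []      A⊆L none = ⨁-zero _ (λ i → ∧-comm (cross K (tree i)) false)
  expand-Σ K (a ∷ A) A⊆L none = begin
    ⨁ (λ i → k i ∧ (P a i xor ΣP A i))           ≡⟨ ⨁-cong (λ i → ∧-distribˡ-xor (k i) (P a i) (ΣP A i)) ⟩
    ⨁ (λ i → (k i ∧ P a i) xor (k i ∧ ΣP A i))   ≡⟨ ⨁-xor (λ i → k i ∧ P a i) (λ i → k i ∧ ΣP A i) ⟩
    ⨁ (λ i → k i ∧ P a i) xor ⨁ (λ i → k i ∧ ΣP A i) ≡⟨ cong₂ _xor_ (sym (expand K (A⊆L (here refl)))) (expand-Σ K A (A⊆L ∘ there) (none ∘ there)) ⟩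
    cross K a xor false                          ≡⟨ cong (_xor false) (none (here refl)) ⟩
    false                                        ∎
    where
    open ≡-Reasoning
    k = λ i → cross K (tree i)

  -- The forest edges in the sum over GF(2) of the fundamental cycles of `f` and of the members of
  -- `A`.
  remaining : Edge n → List (Edge n) → List (Fin size)
  remaining f A = filter (λ i → ¬? (P f i ≟ᵇ ΣP A i)) (allFin size)

  cycleEdges : Edge n → List (Edge n) → List (Edge n)
  cycleEdges f A = A ++ map tree (remaining f A)

  -- A cut crossed by f but by no other edge of the sum of the fundamental cycles of f and A
  -- would contradict the expansion of that cut.
  no-cut : ∀ {f A} → f ∈ L → (∀ {a} → a ∈ A → a ∈ L) → ∀ K → cross K f ≡ true →
    (∀ {e} → e ∈ cycleEdges f A → cross K e ≡ false) → ⊥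
  no-cut {f} {A} f∈L A⊆L K Kf none = contradiction (trans (sym Kf) (trans (expand K f∈L) (trans (⨁-cong agree) (expand-Σ K A A⊆L (none ∘ ∈-++⁺ˡ))))) λ ()
    where
    agree : ∀ i → cross K (tree i) ∧ P f i ≡ cross K (tree i) ∧ ΣP A i
    agree i with P f i ≟ᵇ ΣP A i
    ... | yes eq = cong (cross K (tree i) ∧_) eq
    ... | no neq rewrite none (∈-++⁺ʳ A (∈-map⁺ tree (∈-filter⁺ (λ i → ¬? (P f i ≟ᵇ ΣP A i)) (∈-allFin i) neq))) = refl

-- Chords, and cycles in sums of fundamental cycles

unique-++⁻ : ∀ {A : Set} (xs : List A) {ys} → Unique (xs ++ ys) → (∀ {x} → x ∈ xs → x ∉ ys) × Unique ys
unique-++⁻ []       u        = (λ ()) , u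
unique-++⁻ (x ∷ xs) (x∉ ∷ u) with disj , uys ← unique-++⁻ xs u =
  (λ { (here refl) x∈ys → All.lookup x∉ (∈-++⁺ʳ xs x∈ys) refl ; (there z∈xs) → disj z∈xs }) , uys

module Chords (G : Graph n) (L : List (Edge n)) (L⊆G : ∀ {e} → e ∈ L → IsEdge G e) (L-unique : Unique L)
              (L-asym : ∀ {x y} → (x , y) ∈ L → (y , x) ∈ L → ⊥) (F : Forest L) where
  open Fundamental F public

  private
    both : Unique (tabulate tree ++ chords)
    both = Permₛ.Unique-resp-↭ (setoid (Edge n)) (↭⇒↭ₛ split) L-unique

  chords-unique : Unique chords
  chords-unique = proj₂ (unique-++⁻ (tabulate tree) both)

  tree∉chords : ∀ i → tree i ∉ chords
  tree∉chords i = proj₁ (unique-++⁻ (tabulate tree) both) (∈-tabulate⁺ i)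

  loopless : ∀ {x y} → (x , y) ∈ L → x ≢ y
  loopless xy∈L refl = L-asym xy∈L xy∈L

  -- The cut around a single vertex. An edge crosses the stars of its two endpoints and no others,
  -- so these cuts identify it.
  star : Fin n → Cut n
  star u w = does (u ≟ w)

  star-crosses : ∀ {u x y} → cross (star u) (x , y) ≡ true → u ≡ x ⊎ u ≡ y
  star-crosses {u} {x} {y} eq with u ≟ x | u ≟ y
  ... | yes p | _     = inj₁ p
  ... | no  _ | yes q = inj₂ q
  star-crosses () | no _ | no _

  star-left : ∀ {x y} → x ≢ y → cross (star x) (x , y) ≡ true
  star-left {x} {y} x≢y = cong₂ _xor_ (dec-true (x ≟ x) refl) (dec-false (x ≟ y) x≢y)

  star-right : ∀ {x y} → x ≢ y → cross (star y) (x , y) ≡ true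
  star-right {x} {y} x≢y = cong₂ _xor_ (dec-false (y ≟ x) (x≢y ∘ sym)) (dec-true (y ≟ y) refl)

  P-nonempty : ∀ {e} → e ∈ L → ∃ λ i → P e i ≡ true
  P-nonempty {x , y} e∈L
    with i , eq ← ⨁-true _ (trans (sym (expand (star x) e∈L)) (star-left (loopless e∈L)))
    = i , ∧-true _ eq
    where
    ∧-true : ∀ a {b} → a ∧ b ≡ true → b ≡ true
    ∧-true true eq = eq

  -- Two edges with the same fundamental set cross the same cuts, in particular the same vertex stars.
  P-separates : ∀ {e f} → e ∈ L → f ∈ L → e ≢ f → ∃ λ i → P e i ≢ P f i
  P-separates {x , y} {z , w} e∈L f∈L e≢f with any? (λ i → ¬? (P (x , y) i ≟ᵇ P (z , w) i))
  ... | yes found = found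
  ... | no  none  = contradiction refl (excluded (at (star-left x≢y)) (at (star-right x≢y)))
    where
    x≢y = loopless e∈L
    same : ∀ i → P (x , y) i ≡ P (z , w) i
    same i = decidable-stable (P (x , y) i ≟ᵇ P (z , w) i) (λ neq → none (i , neq))
    at : ∀ {u} → cross (star u) (x , y) ≡ true → u ≡ z ⊎ u ≡ w
    at {u} eq = star-crosses (trans (trans (expand (star u) f∈L)
      (trans (⨁-cong (λ i → cong (cross (star u) (tree i) ∧_) (sym (same i)))) (sym (expand (star u) e∈L)))) eq)
    excluded : x ≡ z ⊎ x ≡ w → y ≡ z ⊎ y ≡ w → x ≢ x
    excluded (inj₁ refl) (inj₁ refl) = ⊥-elim (x≢y refl)
    excluded (inj₁ refl) (inj₂ refl) = ⊥-elim (e≢f refl)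
    excluded (inj₂ refl) (inj₁ refl) = ⊥-elim (L-asym e∈L f∈L)
    excluded (inj₂ refl) (inj₂ refl) = ⊥-elim (x≢y refl)

  -- If `t` were the only element of `P e`, then `P e` would equal the set of `tree t`, which is the
  -- singleton of `t` by duality.
  chord-two : ∀ {e} → e ∈ chords → 2 ≤ count (P e)
  chord-two {e} e∈N = finish (P-nonempty (chord∈L e∈N))
    where
    second : ∀ t → P e t ≡ true → (∃ λ i → P e i ≢ P (tree t) i) → 2 ≤ count (P e)
    second t et (i , neq) with i ≟ t
    ... | yes refl = contradiction (trans et (sym (trans (dual i i) (dec-true (i ≟ i) refl)))) neq
    ... | no  i≢t  = count-two (P e) i≢t (trans (¬-not neq) (cong not (trans (dual i t) (dec-false (i ≟ t) i≢t)))) et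
    finish : (∃ λ t → P e t ≡ true) → 2 ≤ count (P e)
    finish (t , et) = second t et (P-separates (chord∈L e∈N) (tree∈L t) λ eq → tree∉chords t (subst (_∈ chords) eq e∈N))

  -- The condition isolated forces the cycle through f in the sum of the fundamental cycles of f and A
  -- to use every chord in A: it must cross the cut D t, and tree t has been cancelled.
  record Detour (f : Edge n) (A : List (Edge n)) : Set where
    field
      A⊆chords : ∀ {a} → a ∈ A → a ∈ chords
      f∉A      : f ∉ A
      isolated : ∀ {a} → a ∈ A → ∃ λ t → P f t ≡ true × ΣP A t ≡ true × (∀ {b} → b ∈ A → P b t ≡ true → b ≡ a)

  module _ {f : Edge n} {A : List (Edge n)} (f∈N : f ∈ chords) (δ : Detour f A) where
    open Detour δ

    private
      S⊆L : ∀ {e} → e ∈ cycleEdges f A → e ∈ L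
      S⊆L e∈S with ∈-++⁻ A e∈S
      ... | inj₁ e∈A = chord∈L (A⊆chords e∈A)
      ... | inj₂ e∈T with i , _ , refl ← ∈-map⁻ tree e∈T = tree∈L i

      chord-in : ∀ {e} → e ∈ chords → e ∈ cycleEdges f A → e ∈ A
      chord-in e∈N e∈S with ∈-++⁻ A e∈S
      ... | inj₁ e∈A = e∈A
      ... | inj₂ e∈T with i , _ , refl ← ∈-map⁻ tree e∈T = ⊥-elim (tree∉chords i e∈N)

      no-arc : ¬ Arc (cycleEdges f A) (proj₁ f) (proj₂ f)
      no-arc (inj₁ f∈S) = f∉A (chord-in f∈N f∈S)
      no-arc (inj₂ g∈S) = L-asym (chord∈L f∈N) (S⊆L g∈S)

    abstract
      detour-cycle : CycleWithin G (cycleEdges f A) f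
      detour-cycle with cycle-or-cut G (cycleEdges f A) (L⊆G ∘ S⊆L) f (L⊆G (chord∈L f∈N)) (loopless (chord∈L f∈N)) no-arc
      ... | inj₁ C = C
      ... | inj₂ (K , Kf , none) = ⊥-elim (no-cut (chord∈L f∈N) (chord∈L ∘ A⊆chords) K Kf none)

    open CycleWithin detour-cycle

    detour-only : ∀ {e} → e ∈ chords → Uses G cycle e → e ≡ f ⊎ e ∈ A
    detour-only e∈N used with within used
    ... | inj₁ (here eq)   = inj₁ eq
    ... | inj₁ (there e∈S) = inj₂ (chord-in e∈N e∈S)
    ... | inj₂ (here refl) = ⊥-elim (L-asym (chord∈L e∈N) (chord∈L f∈N))
    ... | inj₂ (there e∈S) = ⊥-elim (L-asym (chord∈L e∈N) (S⊆L e∈S))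

    detour-all : ∀ {a} → a ∈ A → Uses G cycle a
    detour-all a∈A with t , ft , At , only ← isolated a∈A with e , e∈S , et , used ← meets (D t) ft with ∈-++⁻ A e∈S
    ... | inj₁ e∈A = subst (Uses G cycle) (only e∈A et) used
    ... | inj₂ e∈T with i , i∈R , refl ← ∈-map⁻ tree e∈T with t ≟ i | dual t i
    -- Only `tree t` among the forest edges crosses `D t`, and it cancels, as `t` lies both in `P f`
    -- and in `ΣP A`.
    ...   | yes refl | _ = contradiction (trans ft (sym At)) (proj₂ (∈-filter⁻ (λ i → ¬? (P f i ≟ᵇ ΣP A i)) {xs = allFin size} i∈R))
    ...   | no _     | d = contradiction (trans (sym d) et) λ ()

  -- The chords on the cycle of a detour are exactly `f` and the members of its list. By `new` the
  -- lists differ pairwise, which gives `suc k` different cycles through `f`.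
  too-many : ∀ {k f} → AtMostKCyclesPerEdge k G → f ∈ chords → (A : Fin (suc k) → List (Edge n)) →
    (∀ i → Detour f (A i)) → (∀ {i j} → i <ᶠ j → ∃ λ a → a ∈ A j × a ∉ A i) → ⊥
  too-many {k} {f} few f∈N A δ new
    with i , j , i≢j , same ← few (proj₁ f) (proj₂ f) (L⊆G (chord∈L f∈N))
           (λ i → CycleWithin.cycle (detour-cycle f∈N (δ i))) (λ i → CycleWithin.through (detour-cycle f∈N (δ i)))
    = [ (λ i<j → clash i<j (λ {e} → Equivalence.from (same (proj₁ e) (proj₂ e))))
      , (λ j<i → clash j<i (λ {e} → Equivalence.to (same (proj₁ e) (proj₂ e)))) ] (compare i j i≢j)
    where
    C : ∀ i → Cycle G
    C i = CycleWithin.cycle (detour-cycle f∈N (δ i))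
    compare : ∀ i j → i ≢ j → i <ᶠ j ⊎ j <ᶠ i
    compare i j i≢j with <ᶠ-cmp i j
    ... | tri< lt _ _ = inj₁ lt
    ... | tri≈ _ eq _ = contradiction eq i≢j
    ... | tri> _ _ gt = inj₂ gt
    clash : ∀ {i j} → i <ᶠ j → (∀ {e} → Uses G (C j) e → Uses G (C i) e) → ⊥
    clash {i} {j} i<j sub with a , a∈Aj , a∉Ai ← new i<j
      with detour-only f∈N (δ i) (Detour.A⊆chords (δ j) a∈Aj) (sub (detour-all f∈N (δ j) a∈Aj))
    ... | inj₁ refl = Detour.f∉A (δ j) a∈Aj
    ... | inj₂ a∈Ai = a∉Ai a∈Ai

  module _ {f : Edge n} (f∈N : f ∈ chords) where

    detour₀ : Detour f []
    detour₀ = record { A⊆chords = λ () ; f∉A = λ () ; isolated = λ () }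

    detour₁ : ∀ {e} → e ∈ chords → f ≢ e → (∃ λ t → P f t ≡ true × P e t ≡ true) → Detour f (e ∷ [])
    detour₁ e∈N f≢e (t , ft , et) = record
      { A⊆chords = λ { (here refl) → e∈N }
      ; f∉A      = λ { (here eq) → f≢e eq }
      ; isolated = λ { (here refl) → t , ft , trans (xor-identityʳ _) et , λ { (here eq) _ → eq } } }

    -- `t` isolates `e` and `s` isolates `g`: each lies in `P f` and in just one of the other two
    -- sets, so nothing cancels there within `ΣP`.
    detour₂ : ∀ {e g t s} → e ∈ chords → g ∈ chords → f ≢ e → f ≢ g →
      P f t ≡ true → P e t ≡ true → P g t ≡ false → P f s ≡ true → P g s ≡ true → P e s ≡ false →
      Detour f (e ∷ g ∷ [])
    detour₂ {e} {g} {t} {s} e∈N g∈N f≢e f≢g ft et gt fs gs es = record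
      { A⊆chords = λ { (here refl) → e∈N ; (there (here refl)) → g∈N }
      ; f∉A      = λ { (here eq) → f≢e eq ; (there (here eq)) → f≢g eq }
      ; isolated = λ
          { (here refl) → t , ft , cong₂ (λ x y → x xor (y xor false)) et gt ,
              λ { (here eq) _ → eq ; (there (here refl)) gt′ → contradiction (trans (sym gt) gt′) λ () }
          ; (there (here refl)) → s , fs , cong₂ (λ x y → x xor (y xor false)) es gs ,
              λ { (here refl) es′ → contradiction (trans (sym es) es′) λ () ; (there (here eq)) _ → eq } } }

-- Classes of overlapping sets and the sizes of their unions

length-filter-¬ : ∀ {A : Set} {Q : A → Set} (Q? : ∀ x → Dec (Q x)) (xs : List A) →
  length (filter Q? xs) + length (filter (¬? ∘ Q?) xs) ≡ length xs
length-filter-¬ Q? []       = refl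
length-filter-¬ Q? (x ∷ xs) with Q? x
... | yes _ = cong suc (length-filter-¬ Q? xs)
... | no  _ = trans (+-suc _ _) (cong suc (length-filter-¬ Q? xs))

module Clusters {A : Set} {m : ℕ} (P : A → Fin m → Bool) where

  Overlap : A → A → Set
  Overlap e f = ∃ λ i → P e i ≡ true × P f i ≡ true

  overlap? : ∀ e f → Dec (Overlap e f)
  overlap? e f = any? (λ i → (P e i ≟ᵇ true) ×-dec (P f i ≟ᵇ true))

  cover : List A → Fin m → Bool
  cover []      i = false
  cover (a ∷ L) i = P a i ∨ cover L i

  cover-∈ : ∀ {L a i} → a ∈ L → P a i ≡ true → cover L i ≡ true
  cover-∈ (here refl) eq rewrite eq = refl
  cover-∈ {b ∷ L} {i = i} (there a∈L) eq rewrite cover-∈ a∈L eq = ∨-zeroʳ (P b i)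

  cover⁻ : ∀ L {i} → cover L i ≡ true → ∃ λ a → a ∈ L × P a i ≡ true
  cover⁻ (a ∷ L) {i} eq with P a i in ai
  ... | true  = a , here refl , ai
  ... | false with b , b∈L , bi ← cover⁻ L eq = b , there b∈L , bi

  cover-⊑ : ∀ L {r} → (∀ {a} → a ∈ L → P a ⊑ r) → cover L ⊑ r
  cover-⊑ L sub i eq with a , a∈L , ai ← cover⁻ L eq = sub a∈L i ai

  Transitive : (A → Set) → Set
  Transitive Q = ∀ {e x y} → Q e → Q x → Q y → e ≢ x → e ≢ y → x ≢ y → Overlap e x → Overlap x y → Overlap e y

  NoFork : (A → Set) → Set
  NoFork Q = ∀ {f e g t s} → Q f → Q e → Q g → f ≢ e → f ≢ g → e ≢ g →
    P f t ≡ true → P e t ≡ true → P g t ≡ false → P f s ≡ true → P g s ≡ true → P e s ≡ false → ⊥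

  -- If `y` misses the element common to `e` and `x`, and `e` misses the one common to `x` and `y`,
  -- then these two elements form a fork at `x`.
  NoFork⇒Transitive : ∀ {Q} → NoFork Q → Transitive Q
  NoFork⇒Transitive no-fork {e} {x} {y} Qe Qx Qy e≢x e≢y x≢y (t , et , xt) (s , xs , ys) with P y t in yt | P e s in es
  ... | true  | _     = t , et , yt
  ... | false | true  = s , es , ys
  ... | false | false = ⊥-elim (no-fork Qx Qe Qy (e≢x ∘ sym) x≢y e≢y xt et yt xs ys es)

  module _ (Q : A → Set) (p q : ℕ) (transitive : Transitive Q)
    (cluster : ∀ e C → Unique (e ∷ C) → All Q (e ∷ C) → All (Overlap e) C →
       p * length (e ∷ C) ≤ q * count (cover (e ∷ C)))
    where

    private
      -- The class `C` of the first element is split off from the rest `B`. By transitivity the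
      -- covers of the two are disjoint, so the bounds add up. As `B` is a filtered list, the
      -- recursion is on a bound for the length.
      bounded : ∀ fuel L → length L ≤ fuel → Unique L → All Q L → p * length L ≤ q * count (cover L)
      bounded _          []      _           _        _         = ≤-trans (≤-reflexive (*-zeroʳ p)) z≤n
      bounded (suc fuel) (e ∷ L) (s≤s L≤) (e∉L ∷ uL) (Qe ∷ QL) = begin
        p * suc (length L)                                   ≡⟨ cong (λ z → p * suc z) (sym (length-filter-¬ (overlap? e) L)) ⟩
        p * (length (e ∷ C) + length B)                      ≡⟨ *-distribˡ-+ p (length (e ∷ C)) (length B) ⟩
        p * length (e ∷ C) + p * length B                    ≤⟨ +-mono-≤
            (cluster e C (All-filter⁺ (overlap? e) e∉L ∷ filter⁺ (overlap? e) uL) (Qe ∷ All-filter⁺ (overlap? e) QL) (all-filter (overlap? e) L))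
            (bounded fuel B (≤-trans B≤L L≤) (filter⁺ (¬? ∘ overlap? e) uL) (All-filter⁺ (¬? ∘ overlap? e) QL)) ⟩
        q * count (cover (e ∷ C)) + q * count (cover B)      ≡⟨ *-distribˡ-+ q (count (cover (e ∷ C))) (count (cover B)) ⟨
        q * (count (cover (e ∷ C)) + count (cover B))        ≤⟨ *-monoʳ-≤ q (count-disjoint _ _ (cover (e ∷ L)) C⊑ B⊑ disjoint) ⟩
        q * count (cover (e ∷ L))                            ∎
        where
        open ≤-Reasoning
        C = filter (overlap? e) L
        B = filter (¬? ∘ overlap? e) L
        B≤L : length B ≤ length L
        B≤L = ≤-trans (m≤n+m (length B) (length C)) (≤-reflexive (length-filter-¬ (overlap? e) L))
        C⊑ : cover (e ∷ C) ⊑ cover (e ∷ L)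
        C⊑ = cover-⊑ (e ∷ C) λ
          { (here refl) i → cover-∈ {e ∷ L} (here refl)
          ; (there a∈C) i → cover-∈ {e ∷ L} (there (proj₁ (∈-filter⁻ (overlap? e) a∈C))) }
        B⊑ : cover B ⊑ cover (e ∷ L)
        B⊑ = cover-⊑ B λ a∈B i → cover-∈ {e ∷ L} (there (proj₁ (∈-filter⁻ (¬? ∘ overlap? e) a∈B)))
        disjoint : ∀ i → cover (e ∷ C) i ≡ true → cover B i ≡ true → ⊥
        disjoint i ci bi with x , x∈ , xi ← cover⁻ (e ∷ C) ci with y , y∈B , yi ← cover⁻ B bi
          with y∈L , ¬ey ← ∈-filter⁻ (¬? ∘ overlap? e) {xs = L} y∈B with x∈
        ... | here refl = ¬ey (i , xi , yi)
        ... | there x∈C with x∈L , ex ← ∈-filter⁻ (overlap? e) {xs = L} x∈C =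
          ¬ey (transitive Qe (All.lookup QL x∈L) (All.lookup QL y∈L) (All.lookup e∉L x∈L) (All.lookup e∉L y∈L)
                 (λ { refl → ¬ey ex }) ex (i , xi , yi))

    cluster-bound : ∀ L → Unique L → All Q L → p * length L ≤ q * count (cover L)
    cluster-bound L = bounded (length L) L ≤-refl

  module _ (Q : A → Set) (two : ∀ {e} → Q e → 2 ≤ count (P e))
           (separate : ∀ {e f} → Q e → Q f → e ≢ f → ∃ λ i → P e i ≢ P f i) where

    single-count : ∀ {e} → Q e → 2 ≤ count (cover (e ∷ []))
    single-count {e} Qe = ≤-trans (two Qe) (count-mono (P e) _ λ i → cover-∈ {e ∷ []} (here refl))

    -- One of the two sets has an element missing from the other, which has two elements itself.
    pair-count : ∀ {e f r} → Q e → Q f → e ≢ f → P e ⊑ r → P f ⊑ r → 3 ≤ count r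
    pair-count {e} {f} {r} Qe Qf e≢f e⊑r f⊑r with i , neq ← separate Qe Qf e≢f with P e i in ei | P f i in fi
    ... | true  | true  = contradiction refl neq
    ... | true  | false = ≤-trans (s≤s (two Qf)) (count-strict (P f) r f⊑r i fi (e⊑r i ei))
    ... | false | true  = ≤-trans (s≤s (two Qe)) (count-strict (P e) r e⊑r i ei (f⊑r i fi))
    ... | false | false = contradiction refl neq

    module _ (no-fork : NoFork Q) where

      private
        -- The union of `P f` and `P g` has three elements, and `i` is a fourth.
        with-private : ∀ {e f g r i} → Q f → Q g → f ≢ g → P e ⊑ r → P f ⊑ r → P g ⊑ r →
          P e i ≡ true → P f i ≡ false → P g i ≡ false → 4 ≤ count r
        with-private {e} {f} {g} {r} {i} Qf Qg f≢g e⊑r f⊑r g⊑r ei fi gi = ≤-trans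
          (s≤s (pair-count Qf Qg f≢g (λ j → cover-∈ {f ∷ g ∷ []} (here refl)) (λ j → cover-∈ {f ∷ g ∷ []} (there (here refl)))))
          (count-strict (cover (f ∷ g ∷ [])) r (cover-⊑ (f ∷ g ∷ []) λ { (here refl) → f⊑r ; (there (here refl)) → g⊑r })
             i (cong₂ (λ a b → a ∨ (b ∨ false)) fi gi) (e⊑r i ei))

        -- Either one of the three sets has an element in neither of the others,
        -- or two elements in exactly two of the sets form a fork.
        half : ∀ {e f g r t} → Q e → Q f → Q g → e ≢ f → e ≢ g → f ≢ g → P e ⊑ r → P f ⊑ r → P g ⊑ r →
          P e t ≡ true → P f t ≡ false → 4 ≤ count r
        half {e} {f} {g} {r} {t} Qe Qf Qg e≢f e≢g f≢g e⊑r f⊑r g⊑r et ft with P g t in gt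
        ... | false = with-private {e} Qf Qg f≢g e⊑r f⊑r g⊑r et ft gt
        ... | true with s , neq ← separate Qe Qg e≢g with P e s in es | P f s in fs | P g s in gs
        ...   | true  | _     | true  = contradiction refl neq
        ...   | false | _     | false = contradiction refl neq
        ...   | true  | false | false = with-private {e} Qf Qg f≢g e⊑r f⊑r g⊑r es fs gs
        ...   | true  | true  | false = ⊥-elim (no-fork Qe Qg Qf e≢g e≢f (f≢g ∘ sym) et gt ft es fs gs)
        ...   | false | false | true  = with-private {g} Qe Qf e≢f g⊑r e⊑r f⊑r gs es fs
        ...   | false | true  | true  = ⊥-elim (no-fork Qg Qe Qf (e≢g ∘ sym) (f≢g ∘ sym) e≢f gt et ft gs fs es)

      -- Some element lies in just one of `P e` and `P f`; up to exchanging `e` and `f` this is the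
      -- situation of `half`.
      triple-count : ∀ {e f g r} → Q e → Q f → Q g → e ≢ f → e ≢ g → f ≢ g → P e ⊑ r → P f ⊑ r → P g ⊑ r → 4 ≤ count r
      triple-count {e} {f} Qe Qf Qg e≢f e≢g f≢g e⊑r f⊑r g⊑r with i , neq ← separate Qe Qf e≢f with P e i in ei | P f i in fi
      ... | true  | true  = contradiction refl neq
      ... | true  | false = half Qe Qf Qg e≢f e≢g f≢g e⊑r f⊑r g⊑r ei fi
      ... | false | true  = half Qf Qe Qg (e≢f ∘ sym) f≢g e≢g f⊑r e⊑r g⊑r fi ei
      ... | false | false = contradiction refl neq

-- The upper bound on the number of edges

forest-size : ∀ {n} {L : List (Edge n)} (F : Forest L) → Forest.size F ≤ n ∸ 1
forest-size {zero}  F = m+n≤o⇒m≤o _ (Forest.small F)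
forest-size {suc n} F = ≤-pred (begin
  suc size                                 ≡⟨ +-comm 1 size ⟩
  -- A nonempty vertex set has at least one component: `rep zero` is a fixed point of `rep`.
  size + 1                                 ≤⟨ +-monoʳ-≤ size (count-positive (λ w → does (rep w ≟ w)) (rep zero) (dec-true (_ ≟ _) (rep-idem zero))) ⟩
  size + count (λ w → does (rep w ≟ w))    ≤⟨ small ⟩
  suc n                                    ∎)
  where
  open Forest F
  open ≤-Reasoning

module _ {A B : Set} (w : A → B → Bool) where

  chosen? : (e : A × B) → Dec (w (proj₁ e) (proj₂ e) ≡ true)
  chosen? (x , y) = w x y ≟ᵇ true

  length-row : ∀ x ys → length (filter chosen? (map (x ,_) ys)) ≡ sum (map (λ y → if w x y then 1 else 0) ys)
  length-row x []       = refl
  length-row x (y ∷ ys) with w x y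
  ... | true  = cong suc (length-row x ys)
  ... | false = length-row x ys

  length-chosen : ∀ xs ys → length (filter chosen? (cartesianProduct xs ys)) ≡
    sum (map (λ x → sum (map (λ y → if w x y then 1 else 0) ys)) xs)
  length-chosen []       ys = refl
  length-chosen (x ∷ xs) ys = begin
    length (filter chosen? (map (x ,_) ys ++ rest))                                   ≡⟨ cong length (filter-++ chosen? (map (x ,_) ys) rest) ⟩
    length (filter chosen? (map (x ,_) ys) ++ filter chosen? rest)                    ≡⟨ length-++ (filter chosen? (map (x ,_) ys)) ⟩
    length (filter chosen? (map (x ,_) ys)) + length (filter chosen? rest)            ≡⟨ cong₂ _+_ (length-row x ys) (length-chosen xs ys) ⟩
    _                                                                                 ∎
    where
    open ≡-Reasoning
    rest = cartesianProduct xs ys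

module _ (G : Graph n) where

  -- Listing an edge only from its smaller to its larger endpoint excludes its reverse from the
  -- list, as `Chords` demands.
  ascending : Fin n → Fin n → Bool
  ascending i j = (toℕ i <ᵇ toℕ j) ∧ adj G i j

  edges : List (Edge n)
  edges = filter (chosen? ascending) (cartesianProduct (allFin n) (allFin n))

  length-edges : length edges ≡ edgeCount G
  length-edges = length-chosen ascending (allFin n) (allFin n)

  edges-unique : Unique edges
  edges-unique = filter⁺ (chosen? ascending) (cartesianProduct⁺ (allFin⁺ n) (allFin⁺ n))

  edges⁻ : ∀ {x y} → (x , y) ∈ edges → toℕ x < toℕ y × adj G x y ≡ true
  edges⁻ {x} {y} e∈ with toℕ x <ᵇ toℕ y in lt | adj G x y | proj₂ (∈-filter⁻ (chosen? ascending) {xs = cartesianProduct (allFin n) (allFin n)} e∈)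
  ... | true | true | _ = <ᵇ⇒< _ _ (subst T (sym lt) _) , refl

  module Spanning = Chords G edges (λ e∈ → proj₂ (edges⁻ e∈)) edges-unique
    (λ e∈ e′∈ → <-asym (proj₁ (edges⁻ e∈)) (proj₁ (edges⁻ e′∈))) (forest edges)

  open Spanning
  open Clusters P

  private
    Q : Edge n → Set
    Q e = e ∈ chords

    separate : ∀ {e f} → Q e → Q f → e ≢ f → ∃ λ i → P e i ≢ P f i
    separate e∈ f∈ = P-separates (chord∈L e∈) (chord∈L f∈)

    flip-overlap : ∀ {e f} → Overlap e f → Overlap f e
    flip-overlap (t , et , ft) = t , ft , et

  -- The lists `[]`, `[e]` and `[g]` yield three different cycles through `f`.
  no-two-overlaps : AtMostKCyclesPerEdge 2 G → ∀ {f e g} → Q f → Q e → Q g → f ≢ e → f ≢ g → e ≢ g →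
    Overlap f e → Overlap f g → ⊥
  no-two-overlaps few {f} {e} {g} Qf Qe Qg f≢e f≢g e≢g fe fg = too-many few Qf A δ new
    where
    A : Fin 3 → List (Edge n)
    A zero             = []
    A (suc zero)       = e ∷ []
    A (suc (suc zero)) = g ∷ []
    δ : ∀ i → Detour f (A i)
    δ zero             = detour₀ Qf
    δ (suc zero)       = detour₁ Qf Qe f≢e fe
    δ (suc (suc zero)) = detour₁ Qf Qg f≢g fg
    new : ∀ {i j} → i <ᶠ j → ∃ λ a → a ∈ A j × a ∉ A i
    new {zero}     {suc zero}       _ = e , here refl , λ ()
    new {zero}     {suc (suc zero)} _ = g , here refl , λ ()
    new {suc zero} {suc (suc zero)} _ = g , here refl , λ { (here eq) → e≢g (sym eq) }
    new {suc zero} {suc zero} (s≤s ())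
    new {suc (suc zero)} {suc zero} (s≤s ())
    new {suc (suc zero)} {suc (suc zero)} (s≤s (s≤s ()))

  no-three-overlaps : AtMostKCyclesPerEdge 3 G → ∀ {f e g h} → Q f → Q e → Q g → Q h →
    f ≢ e → f ≢ g → f ≢ h → e ≢ g → e ≢ h → g ≢ h → Overlap f e → Overlap f g → Overlap f h → ⊥
  no-three-overlaps few {f} {e} {g} {h} Qf Qe Qg Qh f≢e f≢g f≢h e≢g e≢h g≢h fe fg fh = too-many few Qf A δ new
    where
    A : Fin 4 → List (Edge n)
    A zero                   = []
    A (suc zero)             = e ∷ []
    A (suc (suc zero))       = g ∷ []
    A (suc (suc (suc zero))) = h ∷ []
    δ : ∀ i → Detour f (A i)
    δ zero                   = detour₀ Qf
    δ (suc zero)             = detour₁ Qf Qe f≢e fe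
    δ (suc (suc zero))       = detour₁ Qf Qg f≢g fg
    δ (suc (suc (suc zero))) = detour₁ Qf Qh f≢h fh
    new : ∀ {i j} → i <ᶠ j → ∃ λ a → a ∈ A j × a ∉ A i
    new {zero}           {suc zero}             _ = e , here refl , λ ()
    new {zero}           {suc (suc zero)}       _ = g , here refl , λ ()
    new {zero}           {suc (suc (suc zero))} _ = h , here refl , λ ()
    new {suc zero}       {suc (suc zero)}       _ = g , here refl , λ { (here eq) → e≢g (sym eq) }
    new {suc zero}       {suc (suc (suc zero))} _ = h , here refl , λ { (here eq) → e≢h (sym eq) }
    new {suc (suc zero)} {suc (suc (suc zero))} _ = h , here refl , λ { (here eq) → g≢h (sym eq) }
    new {suc zero} {suc zero} (s≤s ())
    new {suc (suc zero)} {suc zero} (s≤s ())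
    new {suc (suc zero)} {suc (suc zero)} (s≤s (s≤s ()))
    new {suc (suc (suc zero))} {suc zero} (s≤s ())
    new {suc (suc (suc zero))} {suc (suc zero)} (s≤s (s≤s ()))
    new {suc (suc (suc zero))} {suc (suc (suc zero))} (s≤s (s≤s (s≤s ())))

  -- The fork makes `[e , g]` a detour in addition to `[]`, `[e]` and `[g]`, which yields four
  -- different cycles through `f`.
  no-fork : AtMostKCyclesPerEdge 3 G → NoFork Q
  no-fork few {f} {e} {g} {t} {s} Qf Qe Qg f≢e f≢g e≢g ft et gt fs gs es = too-many few Qf A δ new
    where
    A : Fin 4 → List (Edge n)
    A zero                   = []
    A (suc zero)             = e ∷ []
    A (suc (suc zero))       = g ∷ []
    A (suc (suc (suc zero))) = e ∷ g ∷ []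
    δ : ∀ i → Detour f (A i)
    δ zero                   = detour₀ Qf
    δ (suc zero)             = detour₁ Qf Qe f≢e (t , ft , et)
    δ (suc (suc zero))       = detour₁ Qf Qg f≢g (s , fs , gs)
    δ (suc (suc (suc zero))) = detour₂ Qf Qe Qg f≢e f≢g ft et gt fs gs es
    new : ∀ {i j} → i <ᶠ j → ∃ λ a → a ∈ A j × a ∉ A i
    new {zero}           {suc zero}             _ = e , here refl , λ ()
    new {zero}           {suc (suc zero)}       _ = g , here refl , λ ()
    new {zero}           {suc (suc (suc zero))} _ = e , here refl , λ ()
    new {suc zero}       {suc (suc zero)}       _ = g , here refl , λ { (here eq) → e≢g (sym eq) }
    new {suc zero}       {suc (suc (suc zero))} _ = g , there (here refl) , λ { (here eq) → e≢g (sym eq) }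
    new {suc (suc zero)} {suc (suc (suc zero))} _ = e , here refl , λ { (here eq) → e≢g eq }
    new {suc zero} {suc zero} (s≤s ())
    new {suc (suc zero)} {suc zero} (s≤s ())
    new {suc (suc zero)} {suc (suc zero)} (s≤s (s≤s ()))
    new {suc (suc (suc zero))} {suc zero} (s≤s ())
    new {suc (suc (suc zero))} {suc (suc zero)} (s≤s (s≤s ()))
    new {suc (suc (suc zero))} {suc (suc (suc zero))} (s≤s (s≤s (s≤s ())))

  private
    covers : ∀ {L a} → a ∈ L → P a ⊑ cover L
    covers a∈L i = cover-∈ a∈L

    all-chords : All Q chords
    all-chords = All.tabulate id

  -- No chord overlaps two others, so classes have size 1 or 2, with covers of at least 2 or 3
  -- elements: 3 ≤ 4 and 6 ≤ 6.
  chords-bound₂ : AtMostKCyclesPerEdge 2 G → 3 * length chords ≤ 2 * count (cover chords)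
  chords-bound₂ few = cluster-bound Q 3 2 transitive cluster chords chords-unique all-chords
    where
    transitive : Transitive Q
    transitive Qe Qx Qy e≢x e≢y x≢y ex xy = ⊥-elim (no-two-overlaps few Qx Qe Qy (e≢x ∘ sym) x≢y e≢y (flip-overlap ex) xy)
    cluster : ∀ e C → Unique (e ∷ C) → All Q (e ∷ C) → All (Overlap e) C → 3 * length (e ∷ C) ≤ 2 * count (cover (e ∷ C))
    cluster e [] _ (Qe ∷ _) _ = ≤-trans (s≤s (s≤s (s≤s z≤n))) (*-monoʳ-≤ 2 (single-count Q chord-two separate Qe))
    cluster e (f ∷ []) ((e≢f ∷ _) ∷ _) (Qe ∷ Qf ∷ _) _ =
      *-monoʳ-≤ 2 (pair-count Q chord-two separate {e} {f} Qe Qf e≢f (covers {e ∷ f ∷ []} (here refl)) (covers {e ∷ f ∷ []} (there (here refl))))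
    cluster e (f ∷ g ∷ _) ((e≢f ∷ e≢g ∷ _) ∷ (f≢g ∷ _) ∷ _) (Qe ∷ Qf ∷ Qg ∷ _) (ef ∷ eg ∷ _) =
      ⊥-elim (no-two-overlaps few Qe Qf Qg e≢f e≢g f≢g ef eg)

  -- Classes of size 1, 2, 3 have covers of at least 2, 3, 4 elements: 4 ≤ 6, 8 ≤ 9 and 12 ≤ 12. A
  -- fourth member would give the first one three overlaps.
  chords-bound₃ : AtMostKCyclesPerEdge 3 G → 4 * length chords ≤ 3 * count (cover chords)
  chords-bound₃ few = cluster-bound Q 4 3 (NoFork⇒Transitive (no-fork few)) cluster chords chords-unique all-chords
    where
    cluster : ∀ e C → Unique (e ∷ C) → All Q (e ∷ C) → All (Overlap e) C → 4 * length (e ∷ C) ≤ 3 * count (cover (e ∷ C))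
    cluster e [] _ (Qe ∷ _) _ = ≤-trans (s≤s (s≤s (s≤s (s≤s z≤n)))) (*-monoʳ-≤ 3 (single-count Q chord-two separate Qe))
    cluster e (f ∷ []) ((e≢f ∷ _) ∷ _) (Qe ∷ Qf ∷ _) _ = ≤-trans (s≤s (s≤s (s≤s (s≤s (s≤s (s≤s (s≤s (s≤s z≤n))))))))
      (*-monoʳ-≤ 3 (pair-count Q chord-two separate {e} {f} Qe Qf e≢f (covers {e ∷ f ∷ []} (here refl)) (covers {e ∷ f ∷ []} (there (here refl)))))
    cluster e (f ∷ g ∷ []) ((e≢f ∷ e≢g ∷ _) ∷ (f≢g ∷ _) ∷ _) (Qe ∷ Qf ∷ Qg ∷ _) _ =
      *-monoʳ-≤ 3 (triple-count Q chord-two separate (no-fork few) {e} {f} {g} Qe Qf Qg e≢f e≢g f≢g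
        (covers {L} (here refl)) (covers {L} (there (here refl))) (covers {L} (there (there (here refl)))))
      where L = e ∷ f ∷ g ∷ []
    cluster e (f ∷ g ∷ h ∷ _) ((e≢f ∷ e≢g ∷ e≢h ∷ _) ∷ (f≢g ∷ f≢h ∷ _) ∷ (g≢h ∷ _) ∷ _) (Qe ∷ Qf ∷ Qg ∷ Qh ∷ _) (ef ∷ eg ∷ eh ∷ _) =
      ⊥-elim (no-three-overlaps few Qe Qf Qg Qh e≢f e≢g e≢h f≢g f≢h g≢h ef eg eh)

  edgeCount-split : edgeCount G ≡ size + length chords
  edgeCount-split = begin
    edgeCount G                                ≡⟨ sym length-edges ⟩
    length edges                               ≡⟨ ↭-length split ⟩
    length (tabulate tree ++ chords)           ≡⟨ length-++ (tabulate tree) ⟩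
    length (tabulate tree) + length chords     ≡⟨ cong (_+ length chords) (length-tabulate tree) ⟩
    size + length chords                       ∎
    where open ≡-Reasoning

  -- The cover consists of forest edges, so `suc k * N ≤ k * size`. Adding `suc k * size` on both
  -- sides bounds `suc k` times the number of edges by `(2 * k + 1) * size`, where `size ≤ n ∸ 1`.
  upper-bound : ∀ k → suc k * length chords ≤ k * count (cover chords) → edgeCount G ≤ cactusBound k n
  upper-bound k few = begin
    edgeCount G                               ≡⟨ edgeCount-split ⟩
    size + N                                  ≡⟨ m*n/n≡m (size + N) (suc k) ⟨
    (size + N) * suc k / suc k                ≤⟨ /-monoˡ-≤ (suc k) scaled ⟩
    (2 * k + 1) * (n ∸ 1) / suc k             ∎
    where
    open ≤-Reasoning
    N = length chords
    scaled : (size + N) * suc k ≤ (2 * k + 1) * (n ∸ 1)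
    scaled = begin
      (size + N) * suc k           ≡⟨ solve 3 (λ s N k → (s :+ N) :* (con 1 :+ k) := (con 1 :+ k) :* s :+ (con 1 :+ k) :* N) refl size N k ⟩
      suc k * size + suc k * N     ≤⟨ +-monoʳ-≤ (suc k * size) (≤-trans few (*-monoʳ-≤ k (count≤n (cover chords)))) ⟩
      suc k * size + k * size      ≡⟨ solve 2 (λ s k → (con 1 :+ k) :* s :+ k :* s := (con 2 :* k :+ con 1) :* s) refl size k ⟩
      (2 * k + 1) * size           ≤⟨ *-monoʳ-≤ (2 * k + 1) (forest-size (forest edges)) ⟩
      (2 * k + 1) * (n ∸ 1)        ∎
      where open +-*-Solver

-- The cyclic successor

toℕ-csuc : (i : Fin (suc m)) → toℕ (csuc i) ≡ suc (toℕ i) ⊎ (toℕ (csuc i) ≡ 0 × toℕ i ≡ m)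
toℕ-csuc {m} i with view i
... | ‵fromℕ     = inj₂ (cong toℕ (csuc-fromℕ m) , toℕ-fromℕ m)
... | ‵inject₁ j = inj₁ (trans (cong toℕ (csuc-inject₁ j)) (cong suc (sym (toℕ-inject₁ j))))

-- Without wrap-around the index grows by two. A return after one wrap-around would make the last
-- index 1, and two wrap-arounds would make it 0, but it is at least 2.
csuc²≢ : ∀ {l} (i : Fin (3 + l)) → csuc (csuc i) ≢ i
csuc²≢ i eq with toℕ-csuc i | toℕ-csuc (csuc i) | cong toℕ eq
... | inj₁ p       | inj₁ q       | e = m≢1+n+m (toℕ i) (trans (sym e) (trans q (cong suc p)))
... | inj₁ p       | inj₂ (q , r) | e = contradiction (trans (sym r) (trans p (cong suc (trans (sym e) q)))) λ ()
... | inj₂ (p , r) | inj₁ q       | e = contradiction (trans (sym r) (trans (sym e) (trans q (cong suc p)))) λ ()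
... | inj₂ (p , _) | inj₂ (_ , r) | _ = contradiction (trans (sym p) r) λ ()

-- `Q` is carried from `i` up to the last index, from there to `zero`, and then up through all
-- indices.
csuc-orbit : (Q : Fin (suc m) → Set) {i : Fin (suc m)} → Q i → (∀ j → Q j → Q (csuc j)) → ∀ j → Q j
csuc-orbit {m} Q {i} Qi next = <-weakInduction Q
  (subst Q (csuc-fromℕ m) (next _ (<-weakInduction-startingFrom Q Qi up (≤fromℕ i)))) up
  where
  up : ∀ j → Q (inject₁ j) → Q (suc j)
  up j Qj = subst Q (csuc-inject₁ j) (next _ Qj)

-- Double counting of edges

sumF : (Fin n → ℕ) → ℕ
sumF {zero}  f = 0
sumF {suc n} f = f zero + sumF (f ∘ suc)

sumF-cong : {f g : Fin n → ℕ} → (∀ i → f i ≡ g i) → sumF f ≡ sumF g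
sumF-cong {zero}  eq = refl
sumF-cong {suc n} eq = cong₂ _+_ (eq zero) (sumF-cong (eq ∘ suc))

sumF-+ : (f g : Fin n → ℕ) → sumF (λ i → f i + g i) ≡ sumF f + sumF g
sumF-+ {zero}  f g = refl
sumF-+ {suc n} f g rewrite sumF-+ (f ∘ suc) (g ∘ suc) =
  solve 4 (λ a b c d → (a :+ b) :+ (c :+ d) := (a :+ c) :+ (b :+ d)) refl (f zero) (g zero) (sumF (f ∘ suc)) (sumF (g ∘ suc))
  where open +-*-Solver

sumF-zero : (n : ℕ) → sumF {n} (λ _ → 0) ≡ 0
sumF-zero zero    = refl
sumF-zero (suc n) = sumF-zero n

sumF-indicator : (p : Fin n → Bool) → sumF (λ i → if p i then 1 else 0) ≡ count p
sumF-indicator {zero}  p = refl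
sumF-indicator {suc n} p = cong ((if p zero then 1 else 0) +_) (sumF-indicator (p ∘ suc))

sum-allFin : (f : Fin n → ℕ) → sum (map f (allFin n)) ≡ sumF f
sum-allFin {n} f = trans (cong sum (map-tabulate id f)) (sum-tabulate f)
  where
  sum-tabulate : ∀ {n} (f : Fin n → ℕ) → sum (tabulate f) ≡ sumF f
  sum-tabulate {zero}  f = refl
  sum-tabulate {suc n} f = cong (f zero +_) (sum-tabulate (f ∘ suc))

double-count : (p : Fin n → Fin m → Bool) → sumF (λ i → count (p i)) ≡ sumF (λ j → count (λ i → p i j))
double-count {zero}  {m} p = sym (sumF-zero m)
double-count {suc n} {m} p = begin
  count (p zero) + sumF (λ i → count (p (suc i)))                                      ≡⟨ cong₂ _+_ (sym (sumF-indicator (p zero))) (double-count (p ∘ suc)) ⟩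
  sumF (λ j → if p zero j then 1 else 0) + sumF (λ j → count (λ i → p (suc i) j))      ≡⟨ sumF-+ (λ j → if p zero j then 1 else 0) (λ j → count (λ i → p (suc i) j)) ⟨
  sumF (λ j → count (λ i → p i j))                                                     ∎
  where open ≡-Reasoning

edgeCount-count : (G : Graph n) → edgeCount G ≡ sumF (λ i → count (λ j → (toℕ i <ᵇ toℕ j) ∧ adj G i j))
edgeCount-count {n} G = trans (sum-allFin {n} _) (sumF-cong {n} λ i →
  trans (sum-allFin (λ j → if (toℕ i <ᵇ toℕ j) ∧ adj G i j then 1 else 0)) (sumF-indicator (λ j → (toℕ i <ᵇ toℕ j) ∧ adj G i j)))

-- Books glued at a vertex

xor-true⇒not : ∀ a b → a xor b ≡ true → a ≡ not b
xor-true⇒not true  false _ = refl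
xor-true⇒not false true  _ = refl

-- Every vertex suc i is adjacent to zero, and the vertices suc i in a common group
-- form a book with spine {zero , suc h}, where h is the hub of the group.
module Books (k m : ℕ) (group : Fin m → ℕ) (pos : Fin m → Fin (suc k))
             (determined : ∀ {i j} → group i ≡ group j → pos i ≡ pos j → i ≡ j) where

  hub : Fin m → Bool
  hub i = does (pos i ≟ zero)

  hub-pos : ∀ i → hub i ≡ true → pos i ≡ zero
  hub-pos i h with pos i ≟ zero
  ... | yes eq = eq

  hub-unique : ∀ i j → group i ≡ group j → hub i ≡ true → hub j ≡ true → i ≡ j
  hub-unique i j g hi hj = determined g (trans (hub-pos i hi) (sym (hub-pos j hj)))

  sibling : Fin m → Fin m → Bool
  sibling i j = does (group i ≟ⁿ group j) ∧ (hub i xor hub j)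

  sibling⁻ : ∀ i j → sibling i j ≡ true → group i ≡ group j × hub i ≡ not (hub j)
  sibling⁻ i j eq with group i ≟ⁿ group j
  ... | yes g rewrite dec-true (group i ≟ⁿ group j) g = g , xor-true⇒not (hub i) (hub j) eq
  ... | no ¬g rewrite dec-false (group i ≟ⁿ group j) ¬g = contradiction eq λ ()

  adjacent : Fin (suc m) → Fin (suc m) → Bool
  adjacent zero    zero    = false
  adjacent zero    (suc _) = true
  adjacent (suc _) zero    = true
  adjacent (suc i) (suc j) = sibling i j

  books : Graph (suc m)
  books = record { adj = adjacent ; sym = adj-sym ; irrefl = adj-irrefl }
    where
    adj-sym : ∀ i j → adjacent i j ≡ adjacent j i
    adj-sym zero    zero    = refl
    adj-sym zero    (suc _) = refl
    adj-sym (suc _) zero    = refl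
    adj-sym (suc i) (suc j) with group i ≟ⁿ group j
    ... | yes g rewrite dec-true (group i ≟ⁿ group j) g | dec-true (group j ≟ⁿ group i) (sym g) = xor-comm (hub i) (hub j)
    ... | no ¬g rewrite dec-false (group i ≟ⁿ group j) ¬g | dec-false (group j ≟ⁿ group i) (¬g ∘ sym) = refl
    adj-irrefl : ∀ i → adjacent i i ≡ false
    adj-irrefl zero    = refl
    adj-irrefl (suc i) rewrite xor-same (hub i) = ∧-zeroʳ _

  books-connected : Connected books
  books-connected zero    zero    = Reach.here
  books-connected zero    (suc v) = Reach.step refl Reach.here
  books-connected (suc u) zero    = Reach.step refl Reach.here
  books-connected (suc u) (suc v) = Reach.step {v = zero} refl (Reach.step refl Reach.here)

  -- A page of a book consists of the edges with a common key; the edge {zero , suc h} is a page by itself.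
  data Key : Fin (suc m) → Fin (suc m) → Fin m → Set where
    down  : ∀ {a} → Key zero (suc a) a
    up    : ∀ {a} → Key (suc a) zero a
    left  : ∀ {a h} → group a ≡ group h → hub a ≡ false → hub h ≡ true → Key (suc a) (suc h) a
    right : ∀ {a h} → group a ≡ group h → hub a ≡ false → hub h ≡ true → Key (suc h) (suc a) a

  Key-sym : ∀ {u v a} → Key u v a → Key v u a
  Key-sym down         = up
  Key-sym up           = down
  Key-sym (left g p h)  = right g p h
  Key-sym (right g p h) = left g p h

  Key-unique : ∀ {u v a b} → Key u v a → Key u v b → a ≡ b
  Key-unique down          down          = refl
  Key-unique up            up            = refl
  Key-unique (left _ _ _)  (left _ _ _)  = refl
  Key-unique (left _ p _)  (right _ _ h) = contradiction (trans (sym p) h) λ ()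
  Key-unique (right _ _ h) (left _ p _)  = contradiction (trans (sym p) h) λ ()
  Key-unique (right _ _ _) (right _ _ _) = refl

  sibling-key : ∀ {i j} → sibling i j ≡ true → Key (suc i) (suc j) i ⊎ Key (suc i) (suc j) j
  sibling-key {i} {j} s with g , h ← sibling⁻ i j s with hub j in hj
  ... | true  = inj₁ (left g h hj)
  ... | false = inj₂ (right (sym g) hj h)

  key : ∀ u v → adjacent u v ≡ true → ∃ (Key u v)
  key zero    (suc a) _ = a , down
  key (suc a) zero    _ = a , up
  key (suc i) (suc j) s with sibling-key {i} {j} s
  ... | inj₁ κ = i , κ
  ... | inj₂ κ = j , κ

  EitherKey : Fin m → Fin m → Fin (suc m) → Fin (suc m) → Set
  EitherKey a b u v = Key u v a ⊎ Key u v b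

  -- Cycles in glued books

  module _ (C : Cycle books) where
    private
      E = CycleEdge C

      E-sym : ∀ {u v} → E u v → E v u
      E-sym (i , e) = i , swap-⊎ e

      link : ∀ i {x y} → vtx C i ≡ x → vtx C (csuc i) ≡ y → adjacent x y ≡ true
      link i ex ey = subst₂ (λ x y → adjacent x y ≡ true) ex ey (closed C i)

      -- A vertex that is not a hub has the hub of its group as its only nonzero neighbour, so the
      -- cycle would turn back at it.
      no-return : ∀ i {a b c} → vtx C i ≡ suc a → vtx C (csuc i) ≡ suc b → vtx C (csuc (csuc i)) ≡ suc c → hub b ≡ true
      no-return i {a} {b} {c} ea eb ec = go (hub b) refl
        where
        ab = sibling⁻ a b (link i ea eb)
        bc = sibling⁻ b c (link (csuc i) eb ec)
        go : ∀ x → hub b ≡ x → hub b ≡ true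
        go true  hb = hb
        go false hb = contradiction (inj C (trans ec (trans (cong suc c≡a) (sym ea)))) (csuc²≢ i)
          where
          c≡a : c ≡ a
          c≡a = hub-unique c a (sym (trans (proj₁ ab) (proj₁ bc)))
            (trans (sym (not-involutive (hub c))) (cong not (trans (sym (proj₂ bc)) hb)))
            (trans (proj₂ ab) (cong not hb))

      Nonzero : Fin (suc m) → Set
      Nonzero u = ∃ λ a → u ≡ suc a

      nonzero : ∀ {u} → u ≢ zero → Nonzero u
      nonzero {zero}  u≢0 = contradiction refl u≢0
      nonzero {suc a} _   = a , refl

      no-hub-siblings : ∀ a b → sibling a b ≡ true → hub a ≡ true → hub b ≡ true → ⊥
      no-hub-siblings a b s ha hb = contradiction (trans (sym ha) (trans (proj₂ (sibling⁻ a b s)) (cong not hb))) λ ()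

      -- The two middle vertices would both be hubs, but of two siblings exactly one is a hub.
      no-three : ∀ i {a b c d} → vtx C i ≡ suc a → vtx C (csuc i) ≡ suc b → vtx C (csuc (csuc i)) ≡ suc c →
        vtx C (csuc (csuc (csuc i))) ≡ suc d → ⊥
      no-three i {a} {b} {c} ea eb ec ed =
        no-hub-siblings b c (link (csuc i) eb ec) (no-return i ea eb ec) (no-return (csuc i) eb ec ed)

      root-index : ∃ λ i → vtx C i ≡ zero
      root-index with any? (λ i → vtx C i ≟ zero)
      ... | yes found = found
      ... | no  none  = ⊥-elim (no-three zero (proj₂ (at zero)) (proj₂ (at _)) (proj₂ (at _)) (proj₂ (at _)))
        where
        at : ∀ i → Nonzero (vtx C i)
        at i = nonzero λ eq → none (i , eq)

    -- The edge set of the cycle is described by two keys alone; cycles with the same two keys are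
    -- therefore the same.
    record TwoPages (a b : Fin m) : Set where
      field
        distinct   : a ≢ b
        same-group : group a ≡ group b
        sound      : ∀ {u v} → E u v → EitherKey a b u v
        complete   : ∀ {u v} → EitherKey a b u v → E u v

    TwoPages-sym : ∀ {a b} → TwoPages a b → TwoPages b a
    TwoPages-sym t = record { distinct = distinct ∘ sym ; same-group = sym same-group
                            ; sound = swap-⊎ ∘ sound ; complete = complete ∘ swap-⊎ }
      where open TwoPages t

    private
      -- The page of a hub is just its edge to `zero`, whence the condition `hub a ≡ false` in the
      -- second component.
      Page : Fin m → Set
      Page a = E zero (suc a) × (∀ h → group a ≡ group h → hub a ≡ false → hub h ≡ true → E (suc a) (suc h))

      page-complete : ∀ {a} → Page a → ∀ {u v} → Key u v a → E u v
      page-complete (r , p) down           = r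
      page-complete (r , p) up             = E-sym r
      page-complete (r , p) (left g n h)   = p _ g n h
      page-complete (r , p) (right g n h)  = E-sym (p _ g n h)

      twoPages : ∀ {a b} → a ≢ b → group a ≡ group b → Page a → Page b →
        (∀ j → EitherKey a b (vtx C j) (vtx C (csuc j))) → TwoPages a b
      twoPages a≢b g pa pb keys = record
        { distinct = a≢b ; same-group = g
        ; sound    = λ { (j , inj₁ (refl , refl)) → keys j ; (j , inj₂ (refl , refl)) → map-⊎ Key-sym Key-sym (keys j) }
        ; complete = [ page-complete pa , page-complete pb ] }

      -- One of the siblings `a` and `b` is the hub, so the cycle consists of a page and the spine.
      triangle : ∀ i {a b} → vtx C i ≡ zero → vtx C (csuc i) ≡ suc a → vtx C (csuc (csuc i)) ≡ suc b →
        vtx C (csuc (csuc (csuc i))) ≡ zero → TwoPages a b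
      triangle i {a} {b} e₀ ea eb e₃ = twoPages a≢b gab
        ((i , inj₁ (e₀ , ea)) , λ h g na hh → csuc i , inj₁ (ea , trans eb (cong suc (hub-unique b h (trans (sym gab) g) (flip-hub a b hab na) hh))))
        ((csuc (csuc i) , inj₂ (eb , e₃)) , λ h g nb hh → csuc i , inj₂ (trans ea (cong suc (hub-unique a h (trans gab g) (trans hab (cong not nb)) hh)) , eb))
        λ j → [ (λ { refl → subst₂ (EitherKey a b) (sym e₀) (sym ea) (inj₁ down) })
              , [ (λ { refl → subst₂ (EitherKey a b) (sym ea) (sym eb) (sibling-key ab) })
                , (λ { refl → subst₂ (EitherKey a b) (sym eb) (sym e₃) (inj₂ up) }) ] ] (three j)
        where
        ab = link (csuc i) ea eb
        gab = proj₁ (sibling⁻ a b ab)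
        hab = proj₂ (sibling⁻ a b ab)
        flip-hub : ∀ a b → hub a ≡ not (hub b) → hub a ≡ false → hub b ≡ true
        flip-hub a b h na = trans (sym (not-involutive (hub b))) (cong not (trans (sym h) na))
        a≢b : a ≢ b
        a≢b refl = not-¬ refl hab
        three : ∀ j → j ≡ i ⊎ j ≡ csuc i ⊎ j ≡ csuc (csuc i)
        three = csuc-orbit _ (inj₁ refl) λ
          { j (inj₁ refl) → inj₂ (inj₁ refl)
          ; j (inj₂ (inj₁ refl)) → inj₂ (inj₂ refl)
          ; j (inj₂ (inj₂ refl)) → inj₁ (inj C (trans e₃ (sym e₀))) }

      -- By `no-return` the vertex `b` is the hub: the cycle goes out along the page of `a` and back
      -- along the page of `c`.
      quadrangle : ∀ i {a b c} → vtx C i ≡ zero → vtx C (csuc i) ≡ suc a → vtx C (csuc (csuc i)) ≡ suc b →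
        vtx C (csuc (csuc (csuc i))) ≡ suc c → vtx C (csuc (csuc (csuc (csuc i)))) ≡ zero → TwoPages a c
      quadrangle i {a} {b} {c} e₀ ea eb ec e₄ = twoPages a≢c (trans gab gbc)
        ((i , inj₁ (e₀ , ea)) , λ h g _ hh → csuc i , inj₁ (ea , trans eb (cong suc (hub-unique b h (trans (sym gab) g) hb hh))))
        ((csuc (csuc (csuc i)) , inj₂ (ec , e₄)) , λ h g _ hh → csuc (csuc i) , inj₂ (trans eb (cong suc (hub-unique b h (trans gbc g) hb hh)) , ec))
        λ j → [ (λ { refl → subst₂ (EitherKey a c) (sym e₀) (sym ea) (inj₁ down) })
              , [ (λ { refl → subst₂ (EitherKey a c) (sym ea) (sym eb) (inj₁ (left gab na hb)) })
                , [ (λ { refl → subst₂ (EitherKey a c) (sym eb) (sym ec) (inj₂ (right (sym gbc) nc hb)) })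
                  , (λ { refl → subst₂ (EitherKey a c) (sym ec) (sym e₄) (inj₂ up) }) ] ] ] (four j)
        where
        ab = sibling⁻ a b (link (csuc i) ea eb)
        bc = sibling⁻ b c (link (csuc (csuc i)) eb ec)
        gab = proj₁ ab
        gbc = proj₁ bc
        hb = no-return (csuc i) ea eb ec
        na : hub a ≡ false
        na = trans (proj₂ ab) (cong not hb)
        nc : hub c ≡ false
        nc = trans (sym (not-involutive (hub c))) (cong not (trans (sym (proj₂ bc)) hb))
        a≢c : a ≢ c
        a≢c refl = csuc²≢ (csuc i) (inj C (trans ec (sym ea)))
        four : ∀ j → j ≡ i ⊎ j ≡ csuc i ⊎ j ≡ csuc (csuc i) ⊎ j ≡ csuc (csuc (csuc i))
        four = csuc-orbit _ (inj₁ refl) λ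
          { j (inj₁ refl) → inj₂ (inj₁ refl)
          ; j (inj₂ (inj₁ refl)) → inj₂ (inj₂ (inj₁ refl))
          ; j (inj₂ (inj₂ (inj₁ refl))) → inj₂ (inj₂ (inj₂ refl))
          ; j (inj₂ (inj₂ (inj₂ refl))) → inj₁ (inj C (trans e₄ (sym e₀))) }

    -- Read from `zero`, the next two vertices are nonzero, and by `no-three` the cycle is back at
    -- `zero` after three or four steps.
    pages : ∃₂ TwoPages
    pages with i , e₀ ← root-index
      with a , ea ← nonzero {vtx C (csuc i)} (λ e₁ → contradiction (link i e₀ e₁) λ ())
      with b , eb ← nonzero {vtx C (csuc (csuc i))} (λ e₂ → csuc²≢ i (inj C (trans e₂ (sym e₀))))
      with vtx C (csuc (csuc (csuc i))) in e₃
    ... | zero  = a , b , triangle i e₀ ea eb e₃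
    ... | suc c with vtx C (csuc (csuc (csuc (csuc i)))) in e₄
    ...   | zero  = a , c , quadrangle i e₀ ea eb e₃ e₄
    ...   | suc d = ⊥-elim (no-three (csuc i) ea eb e₃ e₄)

    second-page : ∀ {u v x} → Key u v x → E u v → ∃ λ y → TwoPages x y
    second-page κ uv with a , b , t ← pages with TwoPages.sound t uv
    ... | inj₁ κ′ with refl ← Key-unique κ κ′ = b , t
    ... | inj₂ κ′ with refl ← Key-unique κ κ′ = a , TwoPages-sym t

  -- Let `x` be the key of the given edge. The second page of a cycle through it lies in the same
  -- group at a position other than `pos x`, which leaves `k` positions for `suc k` cycles.
  books-few-cycles : AtMostKCyclesPerEdge k books
  books-few-cycles u v uv cs through
    with x , κ ← key u v uv
    = conclude (pigeonhole (n<1+n k) code)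
    where
    y : Fin (suc k) → Fin m
    y i = proj₁ (second-page (cs i) κ (through i))
    t : ∀ i → TwoPages (cs i) x (y i)
    t i = proj₂ (second-page (cs i) κ (through i))
    pos≢ : ∀ i → pos x ≢ pos (y i)
    pos≢ i eq = TwoPages.distinct (t i) (determined (TwoPages.same-group (t i)) eq)
    code : Fin (suc k) → Fin k
    code i = punchOut (pos≢ i)
    conclude : (∃₂ λ i j → toℕ i < toℕ j × code i ≡ code j) → ∃₂ λ i j → ¬ (i ≡ j) × SameCycle (cs i) (cs j)
    conclude (i , j , i<j , eq) = i , j , (λ { refl → <-irrefl refl i<j }) , λ a b → mk⇔
      (λ e → TwoPages.complete (t j) (subst (λ z → EitherKey x z a b) yi≡yj (TwoPages.sound (t i) e)))
      (λ e → TwoPages.complete (t i) (subst (λ z → EitherKey x z a b) (sym yi≡yj) (TwoPages.sound (t j) e)))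
      where
      yi≡yj : y i ≡ y j
      yi≡yj = determined (trans (sym (TwoPages.same-group (t i))) (TwoPages.same-group (t j))) (punchOut-injective (pos≢ i) (pos≢ j) eq)

  books-cactus : IsKCactus k books
  books-cactus = books-connected , books-few-cycles

-- The number of edges of glued books

module Tight (k m : ℕ) where

  -- Groups are consecutive blocks of `suc k` indices with the hub in front, so an incomplete last
  -- block still has its hub.
  group : Fin m → ℕ
  group i = toℕ i / suc k

  pos : Fin m → Fin (suc k)
  pos i = fromℕ< (m%n<n (toℕ i) (suc k))

  toℕ-pos : ∀ i → toℕ (pos i) ≡ toℕ i % suc k
  toℕ-pos i = toℕ-fromℕ< (m%n<n (toℕ i) (suc k))

  decompose : ∀ i → toℕ i ≡ toℕ (pos i) + group i * suc k
  decompose i = trans (m≡m%n+[m/n]*n (toℕ i) (suc k)) (cong (_+ group i * suc k) (sym (toℕ-pos i)))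

  determined : ∀ {i j} → group i ≡ group j → pos i ≡ pos j → i ≡ j
  determined {i} {j} g p = toℕ-injective (trans (decompose i)
    (trans (cong₂ (λ a b → toℕ a + b * suc k) p g) (sym (decompose j))))

  open Books k m group pos determined public

  private
    before : Fin m → Fin m → Bool
    before i j = (toℕ i <ᵇ toℕ j) ∧ sibling i j

    before⁻ : ∀ i j → before i j ≡ true → toℕ i < toℕ j × sibling i j ≡ true
    before⁻ i j eq with toℕ i <ᵇ toℕ j in lt | sibling i j
    ... | true | true = <ᵇ⇒< _ _ (subst T (sym lt) _) , refl

    below-hub : ∀ j → hub j ≡ true → count (λ i → before i j) ≡ 0
    below-hub j hj = count-none _ λ i eq → <⇒≱ (proj₁ (before⁻ i j eq)) (hub-first i (proj₁ (sibling⁻ i j (proj₂ (before⁻ i j eq)))))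
      where
      hub-first : ∀ i → group i ≡ group j → toℕ j ≤ toℕ i
      hub-first i g = ≤-trans (≤-reflexive (trans (decompose j) (cong₂ (λ a b → toℕ a + b * suc k) (hub-pos j hj) (sym g))))
        (≤-trans (m≤n+m _ (toℕ (pos i))) (≤-reflexive (sym (decompose i))))

    -- The only smaller sibling is the hub, the first index `group j * suc k` of the block; it is
    -- below `j` because `pos j` is not `zero`.
    below-page : ∀ j → hub j ≡ false → count (λ i → before i j) ≡ 1
    below-page j hj = count-unique _ h before-h λ i eq →
      let i<j , s = before⁻ i j eq ; g , hi = sibling⁻ i j s
      in hub-unique i h (trans g (sym group-h)) (trans hi (cong not hj)) hub-h
      where
      nonzero-pos : pos j ≢ zero
      nonzero-pos eq = contradiction (trans (sym hj) (dec-true (pos j ≟ zero) eq)) λ ()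
      start<j : group j * suc k < toℕ j
      start<j = ≤-trans (+-monoˡ-< (group j * suc k) (n≢0⇒n>0 (λ eq → nonzero-pos (toℕ-injective eq)))) (≤-reflexive (sym (decompose j)))
      start<m : group j * suc k < m
      start<m = ≤-trans start<j (≤-trans (n≤1+n _) (toℕ<n j))
      h : Fin m
      h = fromℕ< start<m
      toℕ-h : toℕ h ≡ group j * suc k
      toℕ-h = toℕ-fromℕ< start<m
      group-h : group h ≡ group j
      group-h = trans (cong (_/ suc k) toℕ-h) (m*n/n≡m (group j) (suc k))
      hub-h : hub h ≡ true
      hub-h = dec-true (pos h ≟ zero) (toℕ-injective (trans (toℕ-pos h) (trans (cong (_% suc k) toℕ-h) (m*n%n≡0 (group j) (suc k)))))
      T⇒≡ : ∀ {b} → T b → b ≡ true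
      T⇒≡ {true} _ = refl
      before-h : before h j ≡ true
      before-h rewrite T⇒≡ (<⇒<ᵇ (≤-trans (≤-reflexive (cong suc toℕ-h)) start<j))
                 | dec-true (group h ≟ⁿ group j) group-h | hub-h | hj = refl

    column : ∀ j → count (λ i → before i j) ≡ (if not (hub j) then 1 else 0)
    column j = go (hub j) refl
      where
      go : ∀ b → hub j ≡ b → count (λ i → before i j) ≡ (if not b then 1 else 0)
      go true  hj = below-hub j hj
      go false hj = below-page j hj

  edgeCount-books : edgeCount books ≡ m + count (λ j → not (hub j))
  edgeCount-books = begin
    edgeCount books                             ≡⟨ edgeCount-count books ⟩
    -- The row of `zero` gives `m` edges; the others are counted by their larger endpoint, once for
    -- each vertex that is not a hub.
    count {m} (λ j → true) + sumF (λ i → count (before i)) ≡⟨ cong₂ _+_ (count-all {m} (λ _ → true) (λ _ → refl)) (double-count before) ⟩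
    m + sumF (λ j → count (λ i → before i j))   ≡⟨ cong (m +_) (trans (sumF-cong column) (sumF-indicator (λ j → not (hub j)))) ⟩
    m + count (λ j → not (hub j))               ∎
    where open ≡-Reasoning

-- A multiple of `suc d` can be taken out of the floor: another `suc d` vertices raise the bound by
-- exactly `a`.
/-shift : ∀ a d m → a + (a * m) / suc d ≡ (a * (suc d + m)) / suc d
/-shift a d m = begin
  a + (a * m) / suc d                       ≡⟨ cong (_+ (a * m) / suc d) (m*n/n≡m a (suc d)) ⟨
  (a * suc d) / suc d + (a * m) / suc d     ≡⟨ +-distrib-/-∣ˡ (a * m) (divides a refl) ⟨
  (a * suc d + a * m) / suc d               ≡⟨ cong (_/ suc d) (*-distribˡ-+ a (suc d) m) ⟨
  (a * (suc d + m)) / suc d                 ∎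
  where open ≡-Reasoning

-- Induction by full books, as `hub` has period 3: three vertices, two of them not hubs, contribute
-- 3 + 2 = 5 edges. The base cases are the incomplete books.
count-pages₂ : ∀ m → m + count (λ j → not (Tight.hub 2 m j)) ≡ 5 * m / 3
count-pages₂ 0 = refl
count-pages₂ 1 = refl
count-pages₂ 2 = refl
count-pages₂ (suc (suc (suc m))) = begin
  3 + m + (2 + c)       ≡⟨ solve 2 (λ m c → con 3 :+ m :+ (con 2 :+ c) := con 5 :+ (m :+ c)) refl m c ⟩
  5 + (m + c)           ≡⟨ cong (5 +_) (count-pages₂ m) ⟩
  5 + 5 * m / 3         ≡⟨ /-shift 5 2 m ⟩
  5 * (3 + m) / 3       ∎
  where
  open ≡-Reasoning
  open +-*-Solver using (solve; _:+_; con; _:=_)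
  c = count (λ j → not (Tight.hub 2 m j))

-- Likewise with period 4: a full book contributes 4 + 3 = 7 edges.
count-pages₃ : ∀ m → m + count (λ j → not (Tight.hub 3 m j)) ≡ 7 * m / 4
count-pages₃ 0 = refl
count-pages₃ 1 = refl
count-pages₃ 2 = refl
count-pages₃ 3 = refl
count-pages₃ (suc (suc (suc (suc m)))) = begin
  4 + m + (3 + c)       ≡⟨ solve 2 (λ m c → con 4 :+ m :+ (con 3 :+ c) := con 7 :+ (m :+ c)) refl m c ⟩
  7 + (m + c)           ≡⟨ cong (7 +_) (count-pages₃ m) ⟩
  7 + 7 * m / 4         ≡⟨ /-shift 7 3 m ⟩
  7 * (4 + m) / 4       ∎
  where
  open ≡-Reasoning
  open +-*-Solver using (solve; _:+_; con; _:=_)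
  c = count (λ j → not (Tight.hub 3 m j))

tight : ∀ k → (∀ m → m + count (λ j → not (Tight.hub k m j)) ≡ (2 * k + 1) * m / suc k) →
  ∀ n → 1 ≤ n → Σ (Graph n) λ G → IsKCactus k G × edgeCount G ≡ cactusBound k n
tight k page-count (suc m) _ = books , books-cactus , trans edgeCount-books (page-count m)
  where open Tight k m

theorem3 : ∀ (k : ℕ) → (k ≡ 2 ⊎ k ≡ 3) →
    ((∀ (n : ℕ) (G : Graph n) → IsKCactus k G → edgeCount G ≤ cactusBound k n)
    × (∀ (n : ℕ) → 1 ≤ n →
    Σ (Graph n) λ G → IsKCactus k G × edgeCount G ≡ cactusBound k n))
theorem3 _ (inj₁ refl) = (λ n G (_ , few) → upper-bound G 2 (chords-bound₂ G few)) , tight 2 count-pages₂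
theorem3 _ (inj₂ refl) = (λ n G (_ , few) → upper-bound G 3 (chords-bound₃ G few)) , tight 3 count-pages₃
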